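{- For every graph $H$ and every $\varepsilon>0$, there exists $N\ge 1$ such that for every $H$-free graph $G$, the vertex set $V(G)$ can be partitioned into at most $N$ sets, each of which is weakly $\varepsilon$-restricted. Moreover, $H$ has the polynomial Rödl property if and only if there is a constant $C_H>0$ such that for every $0<\varepsilon\le 1/2$ one may take $N=(1/\varepsilon)^{C_H}$ in the preceding statement.
   Context: All graphs are finite and simple. A graph $G$ is $H$-free if it contains no induced subgraph isomorphic to $H$. For $\varepsilon>0$, a set $S\subseteq V(G)$ is weakly $\varepsilon$-restricted if one of $G[S]$, $\overline{G}[S]$ (induced subgraphs of $G$ and of its complement on $S$) has at most $\varepsilon|S|^2$ edges. A graph $H$ has the polynomial Rödl property if there exists a constant $C_H>0$ such that for all $0<\varepsilon\le 1/2$ and every $H$-free graph $G$ there is a weakly $\varepsilon$-restricted set $S\subseteq V(G)$ with $|S|\ge \varepsilon^{C_H}|G|$. -}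

module Defs where

open import Data.Bool using (Bool; true; false; _∧_; not; if_then_else_)
open import Data.Nat as ℕ using (ℕ; zero; suc)
open import Data.Fin using (Fin; toℕ)
open import Data.Fin.Subset using (Subset; _∈_; ∣_∣)
open import Data.Vec using (lookup)
open import Data.List using (List; map; concatMap; allFin)
open import Data.Nat.ListAction using (sum)
open import Data.Product using (Σ; _×_; _,_; ∃)
open import Data.Integer using (+_)
open import Data.Rational as ℚ using (ℚ; _≤_; _*_; 1ℚ; 0ℚ; Positive; _/_)
open import Function.Definitions using (Injective)
open import Relation.Binary.PropositionalEquality using (_≡_)
open import Relation.Nullary using (¬_)
open import Relation.Nullary.Decidable using (⌊_⌋)

record Graph (n : ℕ) : Set where
  field
    adj    : Fin n → Fin n → Bool
    sym    : ∀ i j → adj i j ≡ adj j i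
    irrefl : ∀ i → adj i i ≡ false
open Graph public

∣_∣ᵥ : ∀ {n} → Graph n → ℕ
∣_∣ᵥ {n} _ = n

InducedSub : ∀ {h n} → Graph h → Graph n → Set
InducedSub {h} {n} H G =
  Σ (Fin h → Fin n) λ f → Injective _≡_ _≡_ f × (∀ i j → adj G (f i) (f j) ≡ adj H i j)

Free : ∀ {h n} → Graph h → Graph n → Set
Free H G = ¬ InducedSub H G

_Fin≡ᵇ_ : ∀ {n} → Fin n → Fin n → Bool
i Fin≡ᵇ j = ⌊ toℕ i ℕ.≟ toℕ j ⌋

complement : ∀ {n} → Graph n → Graph n
complement {n} G = record
  { adj = λ i j → not (adj G i j) ∧ not (i Fin≡ᵇ j)
  ; sym = λ i j → symC i j
  ; irrefl = λ i → irrC i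
  }
  where
  open import Relation.Binary.PropositionalEquality using (cong₂; refl)
  open import Data.Nat.Properties using (≡ᵇ⇒≡; ≟-diag)
  open import Data.Fin.Properties using (toℕ-injective)
  open import Relation.Nullary.Decidable using (dec-true)
  symEq : ∀ (i j : Fin n) → (i Fin≡ᵇ j) ≡ (j Fin≡ᵇ i)
  symEq i j with toℕ i ℕ.≟ toℕ j | toℕ j ℕ.≟ toℕ i
  ... | Relation.Nullary.yes _ | Relation.Nullary.yes _ = refl
  ... | Relation.Nullary.no _ | Relation.Nullary.no _ = refl
  ... | Relation.Nullary.yes p | Relation.Nullary.no q = Data.Empty.⊥-elim (q (Relation.Binary.PropositionalEquality.sym p))
    where import Data.Empty
  ... | Relation.Nullary.no p | Relation.Nullary.yes q = Data.Empty.⊥-elim (p (Relation.Binary.PropositionalEquality.sym q))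
    where import Data.Empty
  symC : ∀ i j → (not (adj G i j) ∧ not (i Fin≡ᵇ j)) ≡ (not (adj G j i) ∧ not (j Fin≡ᵇ i))
  symC i j = cong₂ (λ a b → not a ∧ not b) (Graph.sym G i j) (symEq i j)
  irrC : ∀ i → (not (adj G i i) ∧ not (i Fin≡ᵇ i)) ≡ false
  irrC i with toℕ i ℕ.≟ toℕ i
  ... | Relation.Nullary.yes _ = Data.Bool.Properties.∧-zeroʳ (not (adj G i i))
    where import Data.Bool.Properties
  ... | Relation.Nullary.no p = Data.Empty.⊥-elim (p refl)
    where import Data.Empty

bool→ℕ : Bool → ℕ
bool→ℕ true  = 1
bool→ℕ false = 0

inS : ∀ {n} → Subset n → Fin n → Bool
inS S i = lookup S i

edges : ∀ {n} → Graph n → Subset n → ℕ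
edges {n} G S = sum (concatMap (λ i → map (λ j →
  bool→ℕ (⌊ toℕ i ℕ.<? toℕ j ⌋ ∧ inS S i ∧ inS S j ∧ adj G i j)) (allFin n)) (allFin n))

ℕ→ℚ : ℕ → ℚ
ℕ→ℚ k = (+ k) / 1

_^ℚ_ : ℚ → ℕ → ℚ
q ^ℚ zero  = 1ℚ
q ^ℚ suc k = q * (q ^ℚ k)

WeaklyRestricted : ∀ {n} → ℚ → Graph n → Subset n → Set
WeaklyRestricted ε G S =
  (ℕ→ℚ (edges G S) ≤ ε * ℕ→ℚ (∣ S ∣ ℕ.* ∣ S ∣))
  Data.Sum.⊎ (ℕ→ℚ (edges (complement G) S) ≤ ε * ℕ→ℚ (∣ S ∣ ℕ.* ∣ S ∣))
  where import Data.Sum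

classOf : ∀ {n k} → (Fin n → Fin k) → Fin k → Subset n
classOf {n} c a = Data.Vec.tabulate (λ v → c v Fin≡ᵇ a)
  where import Data.Vec

-- V(G) can be partitioned into k sets (some possibly empty), each weakly
-- ε-restricted: a colouring c : V(G) → Fin k with each colour class weakly ε-restricted.
RestrictedPartition : ∀ {n} → ℚ → Graph n → ℕ → Set
RestrictedPartition {n} ε G k =
  Σ (Fin n → Fin k) λ c → ∀ a → WeaklyRestricted ε G (classOf c a)

PolyRödl : ∀ {h} → Graph h → Set
PolyRödl H =
  Σ ℕ λ C → (0 ℕ.< C) ×
    (∀ (ε : ℚ) → 0ℚ ℚ.< ε → ε ≤ (+ 1) / 2 → ∀ {n} (G : Graph n) → Free H G →
      Σ (Subset n) λ S → WeaklyRestricted ε G S × ((ε ^ℚ C) * ℕ→ℚ n ≤ ℕ→ℚ ∣ S ∣))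

{-# OPTIONS --safe #-}
module Submission where

-- Partitions from large restricted sets: greedily remove restricted sets until the uncovered part is so
-- small compared with the first set that adding it there keeps that set restricted. If restricted sets
-- of proportion 1/D exist at parameter 1/(2q), each round removes a fixed proportion of all vertices,
-- and O(q D²) classes suffice; this is polynomial in q whenever D is. Conversely, the largest class of
-- a partition into k classes has proportion at least 1/k.
--
-- Large restricted sets, without the regularity lemma: by induction on (a, b), every H-free G has a set
-- of a blocks of size m that is sparse in G, or of b blocks of size m that is sparse in the complement,
-- with m linear in |G|. Embed H greedily into disjoint vertex sets. Where the embedding gets stuck, many
-- vertices A of one set have very few neighbours (or non-neighbours) in another set B. Induction inside B
-- gives a set X that is large enough for those few neighbours to be at most one block, so a block of A
-- can be added to X. Each new block costs only O(m²) edges, so 3a m² edges on a m vertices are sparse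
-- once a is large.

open import Defs hiding (sym)
open import Data.Nat using (ℕ; _≥_)
open import Data.Integer as ℤ using (+_; +[1+_])
open import Data.Rational as ℚ using (ℚ; mkℚ; 0ℚ; 1ℚ; _<_; _≤_; _/_; 1/_)
open import Data.Rational.Properties as ℚ using (pos⇒nonZero)
open import Data.Rational.Base using (positive)
open import Data.Product using (Σ; ∃; _×_; _,_; proj₁; proj₂)
open import Function.Bundles using (_⇔_; mk⇔)

open import Data.Bool using (Bool; true; false; _∧_; _∨_; not; if_then_else_; T)
import Data.Bool.Properties as 𝔹
open import Data.Empty using (⊥; ⊥-elim)
open import Data.Fin using (Fin; zero; suc; toℕ)
import Data.Fin.Properties as 𝔽
open import Data.Nat as ℕ using (zero; suc; _+_; _*_; _^_; z≤n; s≤s)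
import Data.Nat.Properties as ℕ
import Data.Nat.DivMod as ℕ
import Data.Integer.Properties as ℤ
import Data.Rational.Unnormalised as ℚᵘ
import Data.Rational.Unnormalised.Properties as ℚᵘ
open import Data.Fin.Subset using (Subset; ∣_∣)
import Data.List.Base as List hiding (sum)
import Data.List.Properties as List hiding (sum-++)
import Data.Nat.ListAction as List
import Data.Nat.ListAction.Properties as List
open import Data.Nat.Coprimality using (Coprime; 1-coprimeTo) renaming (sym to coprime-sym)
open import Data.Vec using ([]; _∷_; lookup)
import Data.Vec.Properties as Vec
open import Data.Nat.Tactic.RingSolver using (solve-∀)
open import Algebra.Bundles using (CommutativeMonoid)
open import Algebra.Properties.CommutativeSemigroup
  (CommutativeMonoid.commutativeSemigroup ℚ.*-1-commutativeMonoid) using (interchange)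
open import Algebra.Properties.Semiring.Sum ℕ.+-*-semiring
  using (sum; sum-cong-≗; ∑-distrib-+; ∑-comm; *-distribʳ-sum; sum-replicate-zero)
open import Data.Sum using (_⊎_; inj₁; inj₂; [_,_]′)
open import Data.Unit using (tt)
open import Function using (_∘_; id)
open import Function.Definitions using (Injective)
open import Relation.Binary.PropositionalEquality
  using (_≡_; refl; sym; trans; cong; cong₂; subst; subst₂; _≗_)
open import Relation.Nullary using (yes; no; contradiction)
open import Relation.Nullary.Decidable using (_×-dec_; ⌊_⌋; isYes≗does)

private
  variable
    h n : ℕ

-- Finite sums

sum-mono : {f g : Fin n → ℕ} → (∀ i → f i ℕ.≤ g i) → sum f ℕ.≤ sum g
sum-mono {zero} f≤g = z≤n
sum-mono {suc n} f≤g = ℕ.+-mono-≤ (f≤g zero) (sum-mono (f≤g ∘ suc))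

sum-const : ∀ n c → sum {n} (λ _ → c) ≡ n * c
sum-const zero c = refl
sum-const (suc n) c = cong (c ℕ.+_) (sum-const n c)

term≤sum : (f : Fin n → ℕ) → ∀ i → f i ℕ.≤ sum f
term≤sum f zero = ℕ.m≤m+n (f zero) _
term≤sum f (suc i) = ℕ.≤-trans (term≤sum (f ∘ suc) i) (ℕ.m≤n+m _ (f zero))

-- Vertex sets

VSet : ℕ → Set
VSet n = Fin n → Bool

Rel₂ : ℕ → Set
Rel₂ n = Fin n → Fin n → Bool

infix 4 _⊆_ _#_
_⊆_ _#_ : VSet n → VSet n → Set
P ⊆ Q = ∀ v → P v ≡ true → Q v ≡ true
P # Q = ∀ v → P v ≡ true → Q v ≡ true → ⊥

infixl 7 _∪_ _∖_
_∪_ _∖_ : VSet n → VSet n → VSet n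
(P ∪ Q) v = P v ∨ Q v
(P ∖ Q) v = P v ∧ not (Q v)

∅ : VSet n
∅ _ = false

♯ : VSet n → ℕ
♯ P = sum (λ v → bool→ℕ (P v))

deg : Rel₂ n → VSet n → Fin n → ℕ
deg R P u = ♯ (λ v → P v ∧ R u v)

-- Ordered pairs are counted, which makes the count additive over disjoint unions in either
-- argument. For symmetric irreflexive `R`, every edge inside `P` contributes two to `e R P P`.
e : Rel₂ n → VSet n → VSet n → ℕ
e R P Q = sum λ u → sum λ v → bool→ℕ (P u ∧ Q v ∧ R u v)

⊆-trans : {P Q R : VSet n} → P ⊆ Q → Q ⊆ R → P ⊆ R
⊆-trans p q v = q v ∘ p v

∧-true : ∀ a b → a ∧ b ≡ true → (a ≡ true) × (b ≡ true)
∧-true true true _ = refl , refl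

not-true : ∀ a → not a ≡ true → a ≡ false
not-true false _ = refl

∨-elim : ∀ a b {c} → (a ≡ true → c ≡ true) → (b ≡ true → c ≡ true) → a ∨ b ≡ true → c ≡ true
∨-elim true b f g _ = f refl
∨-elim false b f g p = g p

∖-⊆ : (P Q : VSet n) → P ∖ Q ⊆ P
∖-⊆ P Q v p = proj₁ (∧-true (P v) _ p)

∪-⊆ : (P Q : VSet n) {W : VSet n} → P ⊆ W → Q ⊆ W → P ∪ Q ⊆ W
∪-⊆ P Q p q v = ∨-elim (P v) (Q v) (p v) (q v)

#-∖ : (P Q : VSet n) → Q # (P ∖ Q)
#-∖ P Q v q r with Q v | P v
#-∖ P Q v q () | true | true
#-∖ P Q v q () | true | false

bool→ℕ-mono : ∀ {a b} → (a ≡ true → b ≡ true) → bool→ℕ a ℕ.≤ bool→ℕ b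
bool→ℕ-mono {false} _ = z≤n
bool→ℕ-mono {true} f rewrite f refl = ℕ.≤-refl

bool→ℕ-∨ : ∀ a b c → (a ≡ true → b ≡ true → ⊥) →
  bool→ℕ ((a ∨ b) ∧ c) ≡ bool→ℕ (a ∧ c) ℕ.+ bool→ℕ (b ∧ c)
bool→ℕ-∨ false b c _ = refl
bool→ℕ-∨ true false c _ = sym (ℕ.+-identityʳ _)
bool→ℕ-∨ true true c d = ⊥-elim (d refl refl)

♯-mono : {P Q : VSet n} → P ⊆ Q → ♯ P ℕ.≤ ♯ Q
♯-mono p = sum-mono (λ v → bool→ℕ-mono (p v))

♯-cong : {P Q : VSet n} → P ≗ Q → ♯ P ≡ ♯ Q
♯-cong p = sum-cong-≗ (cong bool→ℕ ∘ p)

♯-∅ : ∀ n → ♯ (∅ {n}) ≡ 0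
♯-∅ n = sum-replicate-zero n

♯≤n : (P : VSet n) → ♯ P ℕ.≤ n
♯≤n {n} P = ℕ.≤-trans (sum-mono {g = λ _ → 1} (λ v → bool→ℕ-mono {P v} {true} (λ _ → refl)))
  (ℕ.≤-reflexive (trans (sum-const n 1) (ℕ.*-identityʳ n)))

♯-∪ : {P Q : VSet n} → P # Q → ♯ (P ∪ Q) ≡ ♯ P + ♯ Q
♯-∪ {P = P} {Q} d = trans
  (sum-cong-≗ λ v → subst₂ (λ x y → x ≡ y) (cong bool→ℕ (𝔹.∧-identityʳ (P v ∨ Q v)))
     (cong₂ (λ x y → bool→ℕ x + bool→ℕ y) (𝔹.∧-identityʳ (P v)) (𝔹.∧-identityʳ (Q v)))
     (bool→ℕ-∨ (P v) (Q v) true (d v)))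
  (∑-distrib-+ (bool→ℕ ∘ P) (bool→ℕ ∘ Q))

♯-∖ : {P Q : VSet n} → Q ⊆ P → ♯ P ≡ ♯ Q + ♯ (P ∖ Q)
♯-∖ {P = P} {Q} q = trans (♯-cong λ v → lem (P v) (Q v) (q v)) (♯-∪ (#-∖ P Q))
  where
  lem : ∀ a b → (b ≡ true → a ≡ true) → a ≡ b ∨ (a ∧ not b)
  lem true true _ = refl
  lem true false _ = refl
  lem false true f = f refl
  lem false false _ = refl

e-cong : (R : Rel₂ n) {P Q : VSet n} → P ≗ Q → e R P P ≡ e R Q Q
e-cong R p = sum-cong-≗ λ u → sum-cong-≗ λ v →
  cong bool→ℕ (cong₂ (λ a b → a ∧ b ∧ R u v) (p u) (p v))

e-∪ˡ : (R : Rel₂ n) {P Q : VSet n} (W : VSet n) → P # Q → e R (P ∪ Q) W ≡ e R P W + e R Q W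
e-∪ˡ R {P} {Q} W d = trans
  (sum-cong-≗ λ u → trans
    (sum-cong-≗ λ v → bool→ℕ-∨ (P u) (Q u) (W v ∧ R u v) (d u))
    (∑-distrib-+ (λ v → bool→ℕ (P u ∧ W v ∧ R u v)) (λ v → bool→ℕ (Q u ∧ W v ∧ R u v))))
  (∑-distrib-+ (λ u → sum λ v → bool→ℕ (P u ∧ W v ∧ R u v))
    (λ u → sum λ v → bool→ℕ (Q u ∧ W v ∧ R u v)))

e-flip : (R : Rel₂ n) (P Q : VSet n) → e R P Q ≡ e (λ u v → R v u) Q P
e-flip R P Q = trans
  (∑-comm λ u v → bool→ℕ (P u ∧ Q v ∧ R u v))
  (sum-cong-≗ λ v → sum-cong-≗ λ u → cong bool→ℕ (swap (P u) (Q v)))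
  where
  swap : ∀ a b {c} → a ∧ b ∧ c ≡ b ∧ a ∧ c
  swap true true = refl
  swap true false = refl
  swap false true = refl
  swap false false = refl

e-∪ʳ : (R : Rel₂ n) {P Q : VSet n} (W : VSet n) → P # Q → e R W (P ∪ Q) ≡ e R W P + e R W Q
e-∪ʳ R {P} {Q} W d = trans (e-flip R W (P ∪ Q))
  (trans (e-∪ˡ (λ u v → R v u) W d) (sym (cong₂ _+_ (e-flip R W P) (e-flip R W Q))))

e-∪ : (R : Rel₂ n) {P Q : VSet n} → P # Q →
  e R (P ∪ Q) (P ∪ Q) ≡ (e R P P + e R P Q) + (e R Q P + e R Q Q)
e-∪ R {P} {Q} d = trans (e-∪ˡ R (P ∪ Q) d) (cong₂ _+_ (e-∪ʳ R P d) (e-∪ʳ R Q d))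

e≤♯*deg : (R : Rel₂ n) (P Q : VSet n) (d : ℕ) →
  (∀ u → P u ≡ true → deg R Q u ℕ.≤ d) → e R P Q ℕ.≤ ♯ P * d
e≤♯*deg {n} R P Q d b = ℕ.≤-trans (sum-mono λ u → row u (P u) (b u))
  (ℕ.≤-reflexive (sym (*-distribʳ-sum d (bool→ℕ ∘ P))))
  where
  row : ∀ u p → (p ≡ true → deg R Q u ℕ.≤ d) →
    (sum λ v → bool→ℕ (p ∧ Q v ∧ R u v)) ℕ.≤ bool→ℕ p * d
  row u true f = ℕ.≤-trans (f refl) (ℕ.≤-reflexive (sym (ℕ.+-identityʳ d)))
  row u false f = ℕ.≤-reflexive (sum-replicate-zero n)

e≤♯*♯ : (R : Rel₂ n) (P Q : VSet n) → e R P Q ℕ.≤ ♯ P * ♯ Q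
e≤♯*♯ R P Q = e≤♯*deg R P Q (♯ Q) λ u _ → ♯-mono λ v → proj₁ ∘ ∧-true (Q v) _

deg-mono : (R : Rel₂ n) {P Q : VSet n} → P ⊆ Q → ∀ u → deg R P u ℕ.≤ deg R Q u
deg-mono R {P} {Q} p u = ♯-mono λ v q → lem (P v) (Q v) (p v) q
  where
  lem : ∀ a b {c} → (a ≡ true → b ≡ true) → a ∧ c ≡ true → b ∧ c ≡ true
  lem true b f q rewrite f refl = q

e-∅ : (R : Rel₂ n) → e R ∅ ∅ ≡ 0
e-∅ {n} R = ℕ.n≤0⇒n≡0 (ℕ.≤-trans (e≤♯*♯ R ∅ ∅) (ℕ.≤-reflexive (cong (_* ♯ (∅ {n})) (♯-∅ n))))

subset-of-size : (P : VSet n) (k : ℕ) → k ℕ.≤ ♯ P → Σ (VSet n) λ Q → (Q ⊆ P) × (♯ Q ≡ k)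
subset-of-size {n} P zero _ = ∅ , (λ _ ()) , ♯-∅ n
subset-of-size {suc n} P (suc k) k≤ with P zero in eq
... | true = let (Q , Q⊆ , ♯Q) = subset-of-size (P ∘ suc) k (ℕ.s≤s⁻¹ k≤) in
  (λ { zero → true ; (suc v) → Q v }) , (λ { zero _ → eq ; (suc v) → Q⊆ v }) , cong suc ♯Q
... | false = let (Q , Q⊆ , ♯Q) = subset-of-size (P ∘ suc) (suc k) k≤ in
  (λ { zero → false ; (suc v) → Q v }) , (λ { zero () ; (suc v) → Q⊆ v }) , ♯Q

-- The last component states disjointness by index, the form in which it later makes the embedding
-- of `H` injective.
split : ∀ h L (W : VSet n) → h * L ℕ.≤ ♯ W →
  Σ (Fin h → VSet n) λ C → (∀ j → C j ⊆ W) × (∀ j → ♯ (C j) ≡ L) ×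
    (∀ i j v → C i v ≡ true → C j v ≡ true → i ≡ j)
split zero L W _ = (λ ()) , (λ ()) , (λ ()) , λ ()
split (suc h) L W p = C′ , C′⊆ , C′♯ , C′-disj
  where
  first = subset-of-size W L (ℕ.≤-trans (ℕ.m≤m+n L _) p)
  Q = proj₁ first
  Q⊆ = proj₁ (proj₂ first)
  Q♯ = proj₂ (proj₂ first)
  rest = split h L (W ∖ Q) (ℕ.+-cancelˡ-≤ L _ _
    (ℕ.≤-trans p (ℕ.≤-reflexive (trans (♯-∖ Q⊆) (cong (_+ ♯ (W ∖ Q)) Q♯)))))
  C = proj₁ rest
  C⊆ = proj₁ (proj₂ rest)
  C′ : Fin (suc h) → VSet _
  C′ zero = Q
  C′ (suc j) = C j
  C′⊆ : ∀ j → C′ j ⊆ W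
  C′⊆ zero = Q⊆
  C′⊆ (suc j) = ⊆-trans (C⊆ j) (∖-⊆ W Q)
  C′♯ : ∀ j → ♯ (C′ j) ≡ L
  C′♯ zero = Q♯
  C′♯ (suc j) = proj₁ (proj₂ (proj₂ rest)) j
  C′-disj : ∀ i j v → C′ i v ≡ true → C′ j v ≡ true → i ≡ j
  C′-disj zero zero v p q = refl
  C′-disj zero (suc j) v p q = ⊥-elim (#-∖ W Q v p (C⊆ j v q))
  C′-disj (suc i) zero v p q = ⊥-elim (#-∖ W Q v q (C⊆ i v p))
  C′-disj (suc i) (suc j) v p q = cong suc (proj₂ (proj₂ (proj₂ rest)) i j v p q)

-- If every `B j` were smaller than `K`, at most `i * K` elements would be covered. The extra `K` in
-- the hypothesis, positive by `1 ≤ K`, makes this a strict contradiction, even for `i = 0`.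
♯-pigeonhole : ∀ {i} (P : VSet n) (B : Fin i → VSet n) (K : ℕ) → 1 ℕ.≤ K →
  (∀ v → P v ≡ true → ∃ λ j → B j v ≡ true) → suc i * K ℕ.≤ ♯ P → ∃ λ j → K ℕ.≤ ♯ (B j)
♯-pigeonhole {n} {i} P B K K≥1 cover big with 𝔽.any? (λ j → K ℕ.≤? ♯ (B j))
... | yes p = p
... | no ¬p = contradiction big (ℕ.<⇒≱ (begin-strict
    ♯ P                                      ≤⟨ sum-mono (λ v → covered v (P v) (cover v)) ⟩
    (sum λ v → sum λ j → bool→ℕ (B j v))     ≡⟨ ∑-comm (λ v j → bool→ℕ (B j v)) ⟩
    (sum λ j → ♯ (B j))                      ≤⟨ sum-mono (λ j → ℕ.<⇒≤ (ℕ.≰⇒> (λ q → ¬p (j , q)))) ⟩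
    sum {i} (λ _ → K)                        ≡⟨ sum-const i K ⟩
    i * K                                    <⟨ ℕ.m<n+m (i * K) K≥1 ⟩
    suc i * K                                ∎))
  where
  open ℕ.≤-Reasoning
  covered : ∀ v p → (p ≡ true → ∃ λ j → B j v ≡ true) → bool→ℕ p ℕ.≤ (sum λ j → bool→ℕ (B j v))
  covered v false _ = z≤n
  covered v true f = let (j , q) = f refl in
    ℕ.≤-trans (ℕ.≤-reflexive (cong bool→ℕ (sym q))) (term≤sum (λ j → bool→ℕ (B j v)) j)

-- Rödl's theorem

-- The Boolean is the value of `adj G` on the related pairs, so an entry of `adj H` directly names
-- the side in which an embedding must look for neighbours.
side : Bool → Graph n → Rel₂ n
side true G = adj G
side false G = adj (complement G)

side-sym : ∀ t (G : Graph n) u v → side t G u v ≡ side t G v u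
side-sym true G = Graph.sym G
side-sym false G = Graph.sym (complement G)

-- Only an implication: `side false` excludes the diagonal, so the converse fails at `u = v`.
side-true : ∀ t (G : Graph n) u v → side t G u v ≡ true → adj G u v ≡ t
side-true true G u v p = p
side-true false G u v p = not-true _ (proj₁ (∧-true (not (adj G u v)) _ p))

record Block (R : Rel₂ n) (a m : ℕ) (W : VSet n) : Set where
  constructor block
  field
    S   : VSet n
    S⊆W : S ⊆ W
    ♯S  : ♯ S ≡ a * m
    eS  : e R S S ℕ.≤ a * (3 * (m * m))

Block-mono : {R : Rel₂ n} {a m : ℕ} {V W : VSet n} → V ⊆ W → Block R a m V → Block R a m W
Block-mono V⊆W (block S S⊆ ♯S eS) = block S (⊆-trans S⊆ V⊆W) ♯S eS

∅-Block : (R : Rel₂ n) (a m : ℕ) {W : VSet n} → a * m ≡ 0 → Block R a m W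
∅-Block {n} R a m am≡0 =
  block ∅ (λ _ ()) (trans (♯-∅ n) (sym am≡0)) (ℕ.≤-trans (ℕ.≤-reflexive (e-∅ R)) z≤n)

-- The new pairs are at most `m * m` inside `A` and at most `m * m` in each direction between `A`
-- and `X`, since a vertex of `A` has at most `m` neighbours in `B`, which contains `X`. This is the
-- 3 in `eS`.
Block-extend : {R : Rel₂ n} → (∀ u v → R u v ≡ R v u) → ∀ {a m} (A : VSet n) {B W : VSet n} →
  A ⊆ W → B ⊆ W → A # B → ♯ A ≡ m → (∀ u → A u ≡ true → deg R B u ℕ.≤ m) →
  Block R a m B → Block R (suc a) m W
Block-extend {n} {R} R-sym {a} {m} A {B} A⊆ B⊆ A#B ♯A few (block X X⊆ ♯X eX) =
  block (A ∪ X) (∪-⊆ A X A⊆ (⊆-trans X⊆ B⊆)) (trans (♯-∪ A#X) (cong₂ _+_ ♯A ♯X)) bound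
  where
  A#X : A # X
  A#X v a x = A#B v a (X⊆ v x)
  AX≤ : e R A X ℕ.≤ m * m
  AX≤ = ℕ.≤-trans
    (e≤♯*deg R A X m λ u a → ℕ.≤-trans (deg-mono R X⊆ u) (few u a))
    (ℕ.≤-reflexive (cong (_* m) ♯A))
  XA≡AX : e R X A ≡ e R A X
  XA≡AX = trans (e-flip R X A) (sum-cong-≗ λ u → sum-cong-≗ λ v →
    cong (λ r → bool→ℕ (A u ∧ X v ∧ r)) (R-sym v u))
  expand : ∀ a m → (m * m + m * m) + (m * m + a * (3 * (m * m))) ≡ suc a * (3 * (m * m))
  expand = solve-∀
  open ℕ.≤-Reasoning
  bound : e R (A ∪ X) (A ∪ X) ℕ.≤ suc a * (3 * (m * m))
  bound = begin
    e R (A ∪ X) (A ∪ X)                            ≡⟨ e-∪ R A#X ⟩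
    (e R A A + e R A X) + (e R X A + e R X X)      ≤⟨ ℕ.+-mono-≤
      (ℕ.+-mono-≤ (ℕ.≤-trans (e≤♯*♯ R A A) (ℕ.≤-reflexive (cong₂ _*_ ♯A ♯A))) AX≤)
      (ℕ.+-mono-≤ (ℕ.≤-trans (ℕ.≤-reflexive XA≡AX) AX≤) eX) ⟩
    (m * m + m * m) + (m * m + a * (3 * (m * m)))  ≡⟨ expand a m ⟩
    suc a * (3 * (m * m))                          ∎

Outcome : Graph n → (Bool → ℕ) → ℕ → VSet n → Set
Outcome G a m W = Σ Bool λ t → Block (side t G) (a t) m W

-- The block size may grow during the recursion. `lower` ensures that a vertex with few neighbours
-- sends at most one block's worth of edges; `upper` ensures that the set of such vertices has room
-- for a whole block.
record BoundedOutcome (G : Graph n) (a : Bool → ℕ) (D m : ℕ) (W : VSet n) : Set where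
  constructor bounded
  field
    size    : ℕ
    lower   : m ℕ.≤ size
    upper   : size ℕ.≤ D * m
    outcome : Outcome G a size W

BoundedOutcome-weaken : {G : Graph n} {a : Bool → ℕ} {D D′ m : ℕ} {W : VSet n} → D ℕ.≤ D′ →
  BoundedOutcome G a D m W → BoundedOutcome G a D′ m W
BoundedOutcome-weaken {m = m} D≤ (bounded m′ lo hi o) = bounded m′ lo (ℕ.≤-trans hi (ℕ.*-monoˡ-≤ m D≤)) o

-- (a ∸at t) is suc ∘ a lowered by one at t.
_∸at_ : (Bool → ℕ) → Bool → Bool → ℕ
(a ∸at true) true = a true
(a ∸at true) false = suc (a false)
(a ∸at false) true = suc (a true)
(a ∸at false) false = a false

-- Having few `t`-neighbours in `B`, the set `A` can lengthen a block found on side `t`. On the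
-- other side `a ∸at t` already asks for the full number, and the block is kept as it is.
Outcome-extend : (G : Graph n) (a : Bool → ℕ) (t : Bool) {m : ℕ} (A : VSet n) {B W : VSet n} →
  A ⊆ W → B ⊆ W → A # B → ♯ A ≡ m → (∀ u → A u ≡ true → deg (side t G) B u ℕ.≤ m) →
  Outcome G (a ∸at t) m B → Outcome G (suc ∘ a) m W
Outcome-extend G a true A A⊆ B⊆ A#B ♯A few (true , b) =
  true , Block-extend (side-sym true G) A A⊆ B⊆ A#B ♯A few b
Outcome-extend G a true A A⊆ B⊆ A#B ♯A few (false , b) = false , Block-mono B⊆ b
Outcome-extend G a false A A⊆ B⊆ A#B ♯A few (true , b) = true , Block-mono B⊆ b
Outcome-extend G a false A A⊆ B⊆ A#B ♯A few (false , b) =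
  false , Block-extend (side-sym false G) A A⊆ B⊆ A#B ♯A few b

-- Greedy embedding into disjoint vertex sets

tailGraph : Graph (suc h) → Graph h
tailGraph H = record
  { adj = λ i j → adj H (suc i) (suc j)
  ; sym = λ i j → Graph.sym H (suc i) (suc j)
  ; irrefl = λ i → irrefl H (suc i)
  }

Transversal : Graph h → Graph n → (Fin h → VSet n) → Set
Transversal {h} {n} H G C =
  Σ (Fin h → Fin n) λ f → (∀ j → C j (f j) ≡ true) × (∀ i j → adj G (f i) (f j) ≡ adj H i j)

-- `scale D h * m` is the size that candidate sets need when `h` vertices of `H` are still to be
-- embedded. One step costs a factor `suc i` for the pigeonhole over bad sets and a factor `D` for
-- the inductive call.
scale : ℕ → ℕ → ℕ
scale D zero = 1
scale D (suc i) = suc i * (D * scale D i)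

scale≥1 : ∀ D i → 1 ℕ.≤ D → 1 ℕ.≤ scale D i
scale≥1 D zero D≥1 = ℕ.≤-refl
scale≥1 D (suc i) D≥1 = ℕ.*-mono-≤ {1} {suc i} (s≤s z≤n) (ℕ.*-mono-≤ D≥1 (scale≥1 D i D≥1))

T⇒≡ : ∀ {b} → T b → b ≡ true
T⇒≡ {true} _ = refl

≡⇒T : ∀ {b} → b ≡ true → T b
≡⇒T refl = tt

-- Vertex zero of `H` is sent to some `v` in `C zero` that leaves at least `L` suitable candidates
-- in every other set, and the embedding continues inside those. If there is no such `v`, each
-- vertex of `C zero` is bad for some `j`, so many are bad for the same `j`, and these supply a new
-- block.
transversal-or-outcome : (H : Graph h) (G : Graph n) (a : Bool → ℕ) (D m : ℕ) → 1 ℕ.≤ D → 1 ℕ.≤ m →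
  (∀ t B M → D * M ℕ.≤ ♯ B → BoundedOutcome G (a ∸at t) D M B) →
  ∀ (C : Fin h → VSet n) W → (∀ j → C j ⊆ W) →
  (∀ i j v → C i v ≡ true → C j v ≡ true → i ≡ j) →
  (∀ j → scale D h * m ℕ.≤ ♯ (C j)) →
  Transversal H G C ⊎ BoundedOutcome G (suc ∘ a) (scale D h) m W
transversal-or-outcome {zero} H G a D m _ _ ih C W _ _ _ = inj₁ ((λ ()) , (λ ()) , λ ())
transversal-or-outcome {suc h} {n} H G a D m D≥1 m≥1 ih C W C⊆W C-disj C-big = result
  where
  L = scale D h * m
  K = D * L
  L≥1 : 1 ℕ.≤ L
  L≥1 = ℕ.*-mono-≤ (scale≥1 D h D≥1) m≥1
  R : Fin h → Rel₂ n
  R j = side (adj H zero (suc j)) G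
  nbrs : Fin n → Fin h → VSet n
  nbrs v j w = C (suc j) w ∧ R j v w
  bad : Fin h → VSet n
  bad j v = C zero v ∧ (♯ (nbrs v j) ℕ.<ᵇ L)
  big₀ : suc h * K ℕ.≤ ♯ (C zero)
  big₀ = ℕ.≤-trans (ℕ.≤-reflexive (rearrange (suc h) D (scale D h) m)) (C-big zero)
    where
    rearrange : ∀ x y z w → x * (y * (z * w)) ≡ x * (y * z) * w
    rearrange = solve-∀
  L≤scale : L ℕ.≤ scale D (suc h) * m
  L≤scale = ℕ.*-monoˡ-≤ m (ℕ.≤-trans (ℕ.m≤n*m (scale D h) D ⦃ ℕ.>-nonZero D≥1 ⦄) (ℕ.m≤n*m (D * scale D h) (suc h)))
  K≤scale : K ℕ.≤ scale D (suc h) * m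
  K≤scale = ℕ.≤-trans (ℕ.≤-reflexive (sym (ℕ.*-assoc D (scale D h) m))) (ℕ.*-monoˡ-≤ m (ℕ.m≤n*m (D * scale D h) (suc h)))
  m≤L : m ℕ.≤ L
  m≤L = ℕ.m≤n*m m (scale D h) ⦃ ℕ.>-nonZero (scale≥1 D h D≥1) ⦄

  extend : ∀ v → C zero v ≡ true → Transversal (tailGraph H) G (nbrs v) → Transversal H G C
  extend v v∈ (f , f∈ , f-adj) = f′ , f′∈ , f′-adj
    where
    f′ : Fin (suc h) → Fin n
    f′ zero = v
    f′ (suc j) = f j
    f′∈ : ∀ j → C j (f′ j) ≡ true
    f′∈ zero = v∈
    f′∈ (suc j) = proj₁ (∧-true _ _ (f∈ j))
    v-adj : ∀ j → adj G v (f j) ≡ adj H zero (suc j)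
    v-adj j = side-true (adj H zero (suc j)) G v (f j) (proj₂ (∧-true (C (suc j) (f j)) _ (f∈ j)))
    f′-adj : ∀ i j → adj G (f′ i) (f′ j) ≡ adj H i j
    f′-adj zero zero = trans (irrefl G v) (sym (irrefl H zero))
    f′-adj zero (suc j) = v-adj j
    f′-adj (suc i) zero = trans (Graph.sym G (f i) v) (trans (v-adj i) (Graph.sym H zero (suc i)))
    f′-adj (suc i) (suc j) = f-adj i j

  sparse-pair : ∀ j → K ℕ.≤ ♯ (bad j) → BoundedOutcome G (suc ∘ a) (scale D (suc h)) m W
  sparse-pair j big = bounded m′ (ℕ.≤-trans m≤L lo) (ℕ.≤-trans hi K≤scale)
    (Outcome-extend G a (adj H zero (suc j)) A
      (λ v p → C⊆W zero v (A⊆C₀ v p)) (C⊆W (suc j)) A#B ♯A few o)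
    where
    -- The inductive call asks for blocks of size `L` rather than `m`: bad vertices have fewer than
    -- `L` neighbours in `C (suc j)`, hence at most `m′`. As `m′` is at most `D * L`, which is `K`,
    -- the bad set contains a block of size `m′`.
    inner = ih (adj H zero (suc j)) (C (suc j)) L
      (ℕ.≤-trans K≤scale (C-big (suc j)))
    open BoundedOutcome inner renaming (size to m′; lower to lo; upper to hi; outcome to o)
    sub = subset-of-size (bad j) m′ (ℕ.≤-trans hi big)
    A = proj₁ sub
    ♯A = proj₂ (proj₂ sub)
    A⊆C₀ : A ⊆ C zero
    A⊆C₀ v p = proj₁ (∧-true _ _ (proj₁ (proj₂ sub) v p))
    A#B : A # C (suc j)
    A#B v p q with C-disj zero (suc j) v (A⊆C₀ v p) q
    ... | ()
    few : ∀ u → A u ≡ true → deg (R j) (C (suc j)) u ℕ.≤ m′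
    few u p = ℕ.≤-trans
      (ℕ.<⇒≤ (ℕ.<ᵇ⇒< _ _ (≡⇒T (proj₂ (∧-true (C zero u) _ (proj₁ (proj₂ sub) u p)))))) lo

  result : Transversal H G C ⊎ BoundedOutcome G (suc ∘ a) (scale D (suc h)) m W
  result with 𝔽.any? (λ v → (C zero v 𝔹.≟ true) ×-dec 𝔽.all? (λ j → L ℕ.≤? ♯ (nbrs v j)))
  ... | yes (v , v∈ , good) =
    [ inj₁ ∘ extend v v∈
    , (λ (bounded m′ lo hi o) → inj₂ (bounded m′ lo (ℕ.≤-trans hi L≤scale) o)) ]′
    (transversal-or-outcome (tailGraph H) G a D m D≥1 m≥1 ih (nbrs v) W
      (λ j w p → C⊆W (suc j) w (proj₁ (∧-true _ _ p)))
      (λ i j w p q → 𝔽.suc-injective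
        (C-disj (suc i) (suc j) w (proj₁ (∧-true _ _ p)) (proj₁ (∧-true _ _ q))))
      good)
  ... | no none = let (j , big) = ♯-pigeonhole (C zero) bad K (ℕ.*-mono-≤ D≥1 L≥1) cover big₀ in
    inj₂ (sparse-pair j big)
    where
    cover : ∀ v → C zero v ≡ true → ∃ λ j → bad j v ≡ true
    cover v v∈ =
      let (j , few) = 𝔽.¬∀⟶∃¬ h _ (λ j → L ℕ.≤? ♯ (nbrs v j)) (λ all → none (v , v∈ , all)) in
      j , cong₂ _∧_ v∈ (T⇒≡ (ℕ.<⇒<ᵇ (ℕ.≰⇒> few)))

pair : ℕ → ℕ → Bool → ℕ
pair a b true = a
pair a b false = b

blocks : (H : Graph h) (a b : ℕ) → Σ ℕ λ D → (1 ℕ.≤ D) ×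
  (∀ {n} (G : Graph n) → Free H G → ∀ W m → D * m ℕ.≤ ♯ W → BoundedOutcome G (pair a b) D m W)
blocks H zero b = 1 , ℕ.≤-refl , λ G _ W m _ →
  bounded m ℕ.≤-refl (ℕ.≤-reflexive (sym (ℕ.+-identityʳ m))) (true , ∅-Block (adj G) 0 m refl)
blocks H (suc a) zero = 1 , ℕ.≤-refl , λ G _ W m _ →
  bounded m ℕ.≤-refl (ℕ.≤-reflexive (sym (ℕ.+-identityʳ m))) (false , ∅-Block (adj (complement G)) 0 m refl)
blocks {h} H (suc a) (suc b) = D , ℕ.≤-trans S≥1 (ℕ.m≤n*m (scale D′ h) (suc h)) , main
  where
  ih₁ = blocks H a (suc b)
  ih₂ = blocks H (suc a) b
  D₁ = proj₁ ih₁
  D₂ = proj₁ ih₂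
  -- A common constant for both inductive hypotheses, as the embedding may get stuck on either side.
  D′ = D₁ + D₂
  S≥1 = scale≥1 D′ h (ℕ.≤-trans (proj₁ (proj₂ ih₁)) (ℕ.m≤m+n D₁ D₂))
  -- Room for `h` disjoint candidate sets; `suc h` keeps `D` positive when `H` is empty.
  D = suc h * scale D′ h
  reindex : ∀ {n} {G : Graph n} {f g : Bool → ℕ} {E m W} → f ≗ g →
    BoundedOutcome G f E m W → BoundedOutcome G g E m W
  reindex {G = G} f≗g (bounded m′ lo hi (t , B)) =
    bounded m′ lo hi (t , subst (λ a → Block (side t G) a m′ _) (f≗g t) B)
  main : ∀ {n} (G : Graph n) → Free H G → ∀ W m → D * m ℕ.≤ ♯ W →
    BoundedOutcome G (pair (suc a) (suc b)) D m W
  -- Blocks of size zero are supplied by the empty set; the embedding argument assumes `1 ≤ m`.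
  main G free W zero _ = bounded 0 z≤n z≤n (true , ∅-Block (adj G) (suc a) 0 (ℕ.*-zeroʳ a))
  main {n} G free W m@(suc _) big = finish
    (transversal-or-outcome H G (pair a b) D′ m
      (ℕ.≤-trans (proj₁ (proj₂ ih₁)) (ℕ.m≤m+n D₁ D₂)) (s≤s z≤n) ih
      (proj₁ parts) W (proj₁ (proj₂ parts)) (proj₂ (proj₂ (proj₂ parts)))
      (λ j → ℕ.≤-reflexive (sym (proj₁ (proj₂ (proj₂ parts)) j))))
    where
    parts = split h (scale D′ h * m) W (ℕ.≤-trans (ℕ.m≤n+m (h * (scale D′ h * m)) (scale D′ h * m))
      (ℕ.≤-trans (ℕ.≤-reflexive (sym (ℕ.*-assoc (suc h) (scale D′ h) m))) big))
    C = proj₁ parts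
    ih : ∀ t B M → D′ * M ℕ.≤ ♯ B → BoundedOutcome G (pair a b ∸at t) D′ M B
    ih true B M p = reindex (λ { true → refl ; false → refl })
      (BoundedOutcome-weaken (ℕ.m≤m+n D₁ D₂)
        (proj₂ (proj₂ ih₁) G free B M (ℕ.≤-trans (ℕ.*-monoˡ-≤ M (ℕ.m≤m+n D₁ D₂)) p)))
    ih false B M p = reindex (λ { true → refl ; false → refl })
      (BoundedOutcome-weaken (ℕ.m≤n+m D₂ D₁)
        (proj₂ (proj₂ ih₂) G free B M (ℕ.≤-trans (ℕ.*-monoˡ-≤ M (ℕ.m≤n+m D₂ D₁)) p)))
    finish : Transversal H G C ⊎ BoundedOutcome G (suc ∘ pair a b) (scale D′ h) m W →
      BoundedOutcome G (pair (suc a) (suc b)) D m W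
    finish (inj₁ (f , f∈ , f-adj)) = ⊥-elim (free (f , injective , f-adj))
      where
      injective : Injective _≡_ _≡_ f
      injective {i} {j} fi≡fj = proj₂ (proj₂ (proj₂ parts)) i j (f i) (f∈ i)
        (subst (λ v → C j v ≡ true) (sym fi≡fj) (f∈ j))
    finish (inj₂ o) = reindex (λ { true → refl ; false → refl })
      (BoundedOutcome-weaken (ℕ.m≤n*m (scale D′ h) (suc h)) o)

-- Large restricted sets from blocks

ord : Rel₂ n → Rel₂ n
ord R u v = ⌊ toℕ u ℕ.<? toℕ v ⌋ ∧ R u v

-- The edge bound for ε = 1/q, cleared of denominators; `ord` counts each edge once, as `edges`
-- does.
Sparse : ℕ → Rel₂ n → VSet n → Set
Sparse q R P = q * e (ord R) P P ℕ.≤ ♯ P * ♯ P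

Restricted : ℕ → Graph n → VSet n → Set
Restricted q G P = ∃ λ t → Sparse q (side t G) P

e-ord≤e : (R : Rel₂ n) (P : VSet n) → e (ord R) P P ℕ.≤ e R P P
e-ord≤e R P = sum-mono λ u → sum-mono λ v →
  bool→ℕ-mono (weaken (P u) (P v) ⌊ toℕ u ℕ.<? toℕ v ⌋)
  where
  weaken : ∀ a b c {d} → a ∧ b ∧ c ∧ d ≡ true → a ∧ b ∧ d ≡ true
  weaken true true true p = p

-- With `3 * q` blocks the two sides match exactly: q · (3q · 3m²) = (3qm)².
Block⇒Sparse : ∀ q (R : Rel₂ n) {m W} (B : Block R (3 * q) m W) → Sparse q R (Block.S B)
Block⇒Sparse q R {m} (block S _ ♯S eS) = begin
  q * e (ord R) S S          ≤⟨ ℕ.*-monoʳ-≤ q (ℕ.≤-trans (e-ord≤e R S) eS) ⟩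
  q * (3 * q * (3 * (m * m)))  ≡⟨ square q m ⟩
  3 * q * m * (3 * q * m)    ≡⟨ cong₂ _*_ ♯S ♯S ⟨
  ♯ S * ♯ S                  ∎
  where
  open ℕ.≤-Reasoning
  square : ∀ q m → q * (3 * q * (3 * (m * m))) ≡ 3 * q * m * (3 * q * m)
  square = solve-∀

singleton-Restricted : ∀ q (G : Graph (suc n)) →
  Σ (VSet (suc n)) λ S → Restricted q G S × ♯ S ≡ 1
singleton-Restricted {n} q G = S , (true , ℕ.≤-trans (ℕ.≤-reflexive (trans (cong (q *_) e≡0) (ℕ.*-zeroʳ q))) z≤n)
  , cong suc (sum-replicate-zero n)
  where
  S : VSet (suc n)
  S zero = true
  S (suc _) = false
  e≡0 : e (ord (adj G)) S S ≡ 0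
  e≡0 = cong₂ _+_ (sum-replicate-zero n)
    (trans (sum-cong-≗ {n} {_} {λ _ → 0} λ _ → sum-replicate-zero n) (sum-replicate-zero n))

-- Blocks of size at least `m`, the quotient of `n` by `D`, suffice when `m` is positive, as n ≤ D +
-- D m ≤ 2 D m. Nonempty graphs with fewer than `D` vertices are served by a singleton.
large-restricted-set : (H : Graph h) (q : ℕ) → 1 ℕ.≤ q → Σ ℕ λ D →
  ∀ {n} (G : Graph n) → Free H G → Σ (VSet n) λ S → Restricted q G S × n ℕ.≤ D * ♯ S
large-restricted-set H q q≥1 = 2 * D , find
  where
  base = blocks H (3 * q) (3 * q)
  D = proj₁ base
  instance
    D≢0 : ℕ.NonZero D
    D≢0 = ℕ.>-nonZero (proj₁ (proj₂ base))
  find : ∀ {n} (G : Graph n) → Free H G → Σ (VSet n) λ S → Restricted q G S × n ℕ.≤ 2 * D * ♯ S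
  find {zero} G free = ∅ , (true , ℕ.≤-reflexive (ℕ.*-zeroʳ q)) , z≤n
  find {n@(suc _)} G free with n ℕ./ D in eq
  ... | zero = let (S , S-res , ♯S) = singleton-Restricted q G in S , S-res , (begin
      n            ≤⟨ ℕ.<⇒≤ (ℕ.m/n≡0⇒m<n eq) ⟩
      D            ≤⟨ ℕ.m≤n*m D 2 ⟩
      2 * D        ≡⟨ ℕ.*-identityʳ (2 * D) ⟨
      2 * D * 1    ≡⟨ cong (2 * D *_) ♯S ⟨
      2 * D * ♯ S  ∎)
    where open ℕ.≤-Reasoning
  ... | m@(suc m-1) = from-outcome (proj₂ (proj₂ base) G free (λ _ → true) m Dm≤)
    where
    open ℕ.≤-Reasoning
    Dm≤ : D * m ℕ.≤ ♯ {n} (λ _ → true)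
    Dm≤ = begin
      D * m              ≡⟨ cong (D *_) eq ⟨
      D * (n ℕ./ D)      ≡⟨ ℕ.*-comm D (n ℕ./ D) ⟩
      n ℕ./ D * D        ≤⟨ ℕ.m/n*n≤m n D ⟩
      n                  ≡⟨ ℕ.*-identityʳ n ⟨
      n * 1              ≡⟨ sum-const n 1 ⟨
      ♯ {n} (λ _ → true) ∎
    n≤ : ∀ {s} → m ℕ.≤ s → n ℕ.≤ 2 * D * s
    n≤ {s} m≤s = begin
      n                         ≡⟨ ℕ.m≡m%n+[m/n]*n n D ⟩
      n ℕ.% D + n ℕ./ D * D     ≤⟨ ℕ.+-monoˡ-≤ (n ℕ./ D * D) (ℕ.<⇒≤ (ℕ.m%n<n n D)) ⟩
      D + n ℕ./ D * D           ≡⟨ cong (λ k → D + k * D) eq ⟩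
      D + m * D                 ≤⟨ ℕ.+-monoˡ-≤ (m * D) (ℕ.m≤n*m D m) ⟩
      m * D + m * D             ≡⟨ double m D ⟩
      2 * D * m                 ≤⟨ ℕ.*-monoʳ-≤ (2 * D) m≤s ⟩
      2 * D * s                 ∎
      where
      double : ∀ m D → m * D + m * D ≡ 2 * D * m
      double = solve-∀
    restricted : ∀ t {m′} (B : Block (side t G) (3 * q) m′ (λ _ → true)) → m ℕ.≤ m′ →
      Σ (VSet n) λ S → Restricted q G S × n ℕ.≤ 2 * D * ♯ S
    restricted t {m′} B m≤ = Block.S B , (t , Block⇒Sparse q (side t G) B) , n≤ (begin
      m               ≤⟨ m≤ ⟩
      m′              ≤⟨ ℕ.m≤n*m m′ (3 * q) ⦃ ℕ.>-nonZero (ℕ.*-mono-≤ {1} {3} (s≤s z≤n) q≥1) ⦄ ⟩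
      3 * q * m′      ≡⟨ Block.♯S B ⟨
      ♯ (Block.S B)   ∎)
    from-outcome : BoundedOutcome G (pair (3 * q) (3 * q)) D m (λ _ → true) →
      Σ (VSet n) λ S → Restricted q G S × n ℕ.≤ 2 * D * ♯ S
    from-outcome (bounded m′ m≤ _ (true , B)) = restricted true B m≤
    from-outcome (bounded m′ m≤ _ (false , B)) = restricted false B m≤

-- Induced subgraphs

-- `P` is listed in increasing order, because `ord` compares indices and `complement` tests them for
-- equality. `at-<` and `at-≡` are Boolean equations, so that both tests carry over exactly; `image`
-- carries sets found in the induced subgraph back into `P`.
record Enumeration (P : VSet n) : Set where
  field
    size   : ℕ
    at     : Fin size → Fin n
    size≡♯ : size ≡ ♯ P
    at-<   : ∀ i j → (toℕ i ℕ.<ᵇ toℕ j) ≡ (toℕ (at i) ℕ.<ᵇ toℕ (at j))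
    at-≡   : ∀ i j → (toℕ i ℕ.≡ᵇ toℕ j) ≡ (toℕ (at i) ℕ.≡ᵇ toℕ (at j))
    sum-at : ∀ g → (∀ v → P v ≡ false → g v ≡ 0) → sum (g ∘ at) ≡ sum g
    image  : ∀ (S′ : VSet size) → Σ (VSet n) λ S → (S ⊆ P) × (∀ i → S (at i) ≡ S′ i)

enumerate : (P : VSet n) → Enumeration P
enumerate {zero} P = record
  { size = 0
  ; at = λ ()
  ; size≡♯ = refl
  ; at-< = λ ()
  ; at-≡ = λ ()
  ; sum-at = λ _ _ → refl
  ; image = λ _ → (λ ()) , (λ ()) , λ ()
  }
enumerate {suc n} P with P zero in eq | enumerate (P ∘ suc)
... | true | E = record
  { size = suc size
  ; at = at′
  ; size≡♯ = cong₂ _+_ (cong bool→ℕ (sym eq)) size≡♯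
  ; at-< = λ { zero zero → refl ; zero (suc j) → refl ; (suc i) zero → refl ; (suc i) (suc j) → at-< i j }
  ; at-≡ = λ { zero zero → refl ; zero (suc j) → refl ; (suc i) zero → refl ; (suc i) (suc j) → at-≡ i j }
  ; sum-at = λ g g0 → cong (g zero ℕ.+_) (sum-at (g ∘ suc) (g0 ∘ suc))
  ; image = λ S′ → let (S , S⊆ , S-at) = image (S′ ∘ suc) in
      (λ { zero → S′ zero ; (suc v) → S v })
      , (λ { zero _ → eq ; (suc v) → S⊆ v })
      , λ { zero → refl ; (suc i) → S-at i }
  }
  where
  open Enumeration E
  at′ : Fin (suc size) → Fin (suc n)
  at′ zero = zero
  at′ (suc i) = suc (at i)
... | false | E = record
  { size = size
  ; at = suc ∘ at
  ; size≡♯ = trans size≡♯ (cong (λ b → bool→ℕ b + ♯ (P ∘ suc)) (sym eq))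
  ; at-< = at-<
  ; at-≡ = at-≡
  ; sum-at = λ g g0 → trans (sum-at (g ∘ suc) (g0 ∘ suc)) (cong (_+ sum (g ∘ suc)) (sym (g0 zero eq)))
  ; image = λ S′ → let (S , S⊆ , S-at) = image S′ in
      (λ { zero → false ; (suc v) → S v })
      , (λ { zero () ; (suc v) → S⊆ v })
      , S-at
  }
  where open Enumeration E

module Induced (G : Graph n) {P : VSet n} (E : Enumeration P) where
  open Enumeration E

  induced : Graph size
  induced = record
    { adj = λ i j → adj G (at i) (at j)
    ; sym = λ i j → Graph.sym G (at i) (at j)
    ; irrefl = λ i → irrefl G (at i)
    }

  at-injective : Injective _≡_ _≡_ at
  at-injective {i} {j} p = 𝔽.toℕ-injective (ℕ.≡ᵇ⇒≡ (toℕ i) (toℕ j) (≡⇒T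
    (trans (at-≡ i j) (T⇒≡ (ℕ.≡⇒≡ᵇ (toℕ (at i)) (toℕ (at j)) (cong toℕ p))))))

  induced-free : (H : Graph h) → Free H G → Free H induced
  induced-free H free (f , f-inj , f-adj) = free (at ∘ f , f-inj ∘ at-injective , f-adj)

  side-at : ∀ t i j → side t induced i j ≡ side t G (at i) (at j)
  side-at true i j = refl
  side-at false i j = cong (λ b → not (adj G (at i) (at j)) ∧ not b)
    (trans (isYes≗does (toℕ i ℕ.≟ toℕ j))
      (trans (at-≡ i j) (sym (isYes≗does (toℕ (at i) ℕ.≟ toℕ (at j))))))

  ord-at : ∀ t i j → ord (side t induced) i j ≡ ord (side t G) (at i) (at j)
  ord-at t i j = cong₂ _∧_
    (trans (isYes≗does (toℕ i ℕ.<? toℕ j))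
      (trans (at-< i j) (sym (isYes≗does (toℕ (at i) ℕ.<? toℕ (at j))))))
    (side-at t i j)

  module _ {S : VSet n} {S′ : VSet size} (S⊆P : S ⊆ P) (S-at : ∀ i → S (at i) ≡ S′ i) where

    S-false : ∀ v → P v ≡ false → S v ≡ false
    S-false v Pv with S v in Sv
    ... | false = refl
    ... | true with trans (sym Pv) (S⊆P v Sv)
    ...   | ()

    ♯-at : ♯ S′ ≡ ♯ S
    ♯-at = trans (♯-cong (sym ∘ S-at)) (sum-at (bool→ℕ ∘ S) λ v → cong bool→ℕ ∘ S-false v)

    -- The summand vanishes as soon as one vertex lies outside `P`, since `S ⊆ P`. Hence both sums
    -- extend from the enumerated vertices to all of them.
    e-at : ∀ t → e (ord (side t induced)) S′ S′ ≡ e (ord (side t G)) S S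
    e-at t = trans
      (sum-cong-≗ λ i → sum-cong-≗ λ j → cong bool→ℕ
        (cong₂ _∧_ (sym (S-at i)) (cong₂ _∧_ (sym (S-at j)) (ord-at t i j))))
      (trans (sum-cong-≗ λ i → sum-at (F (at i)) (F-column (at i)))
        (sum-at (sum ∘ F) F-row))
      where
      F : Fin n → Fin n → ℕ
      F u v = bool→ℕ (S u ∧ S v ∧ ord (side t G) u v)
      F-row : ∀ u → P u ≡ false → sum (F u) ≡ 0
      F-row u p rewrite S-false u p = sum-replicate-zero n
      F-column : ∀ u v → P v ≡ false → F u v ≡ 0
      F-column u v p rewrite S-false v p = cong bool→ℕ (𝔹.∧-zeroʳ (S u))

    Restricted-at : ∀ q → Restricted q induced S′ → Restricted q G S
    Restricted-at q (t , sparse) = t , subst₂ ℕ._≤_ (cong (q *_) (e-at t)) (cong₂ _*_ ♯-at ♯-at) sparse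

FindsRestricted : Graph h → ℕ → ℕ → Set
FindsRestricted H q D =
  ∀ {n} (G : Graph n) → Free H G → Σ (VSet n) λ S → Restricted q G S × n ℕ.≤ D * ♯ S

-- Induced subgraphs of an `H`-free graph are `H`-free, so `finds` applies to the subgraph on `P`.
restricted-within : {H : Graph h} (q D : ℕ) → FindsRestricted H q D → (G : Graph n) → Free H G →
  ∀ (P : VSet n) → Σ (VSet n) λ S → (S ⊆ P) × Restricted q G S × ♯ P ℕ.≤ D * ♯ S
restricted-within {H = H} q D finds G free P = S , S⊆P , Restricted-at S⊆P S-at q (proj₁ (proj₂ found)) ,
  subst₂ (λ x y → x ℕ.≤ D * y) size≡♯ (♯-at S⊆P S-at) (proj₂ (proj₂ found))
  where
  E = enumerate P
  open Enumeration E
  open Induced G E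
  found = finds induced (induced-free H free)
  S′ = proj₁ found
  S = proj₁ (image S′)
  S⊆P = proj₁ (proj₂ (image S′))
  S-at = proj₂ (proj₂ (image S′))

-- Greedy partition

Restricted-cong : ∀ q (G : Graph n) {P Q : VSet n} → P ≗ Q → Restricted q G P → Restricted q G Q
Restricted-cong q G p (t , sparse) =
  t , subst₂ (λ x y → q * x ℕ.≤ y) (e-cong (ord (side t G)) p) (cong₂ _*_ (♯-cong p) (♯-cong p)) sparse

Restricted-weaken : ∀ q (G : Graph n) {P : VSet n} → Restricted (2 * q) G P → Restricted q G P
Restricted-weaken q G (t , sparse) = t , ℕ.≤-trans (ℕ.*-monoˡ-≤ _ (ℕ.m≤n*m q 2)) sparse

Restricted-∅ : ∀ q (G : Graph n) → Restricted q G ∅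
Restricted-∅ q G = true , ℕ.≤-trans
  (ℕ.≤-reflexive (trans (cong (q *_) (e-∅ (ord (adj G)))) (ℕ.*-zeroʳ q))) z≤n

-- Every pair meeting `R` is counted as an edge. With s = ♯S and r = ♯R, the bounds 2q e(S,S) ≤ s²,
-- 4qrs ≤ s² and 2qr² ≤ sr add up to at most 2(s + r)². Thus half the allowance goes to `S`, and
-- `2 * q` is the parameter required of it.
Restricted-∪ : ∀ q (G : Graph n) {S R : VSet n} → S # R → 4 * q * ♯ R ℕ.≤ ♯ S →
  Restricted (2 * q) G S → Restricted q G (S ∪ R)
Restricted-∪ q G {S} {R} S#R small (t , sparse) = t , ℕ.*-cancelˡ-≤ 2 (begin
  2 * (q * e O (S ∪ R) (S ∪ R))                          ≡⟨ cong (λ x → 2 * (q * x)) (e-∪ O S#R) ⟩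
  2 * (q * ((e O S S + e O S R) + (e O R S + e O R R)))  ≤⟨ ℕ.*-monoʳ-≤ 2 (ℕ.*-monoʳ-≤ q
    (ℕ.+-mono-≤ (ℕ.+-monoʳ-≤ (e O S S) (e≤♯*♯ O S R)) (ℕ.+-mono-≤ (e≤♯*♯ O R S) (e≤♯*♯ O R R)))) ⟩
  2 * (q * ((e O S S + s * r) + (r * s + r * r)))        ≡⟨ collect q (e O S S) s r ⟩
  2 * q * e O S S + (4 * q * r * s + 2 * q * r * r)      ≤⟨ ℕ.+-mono-≤ sparse
    (ℕ.+-mono-≤ (ℕ.*-monoˡ-≤ s small) (ℕ.*-monoˡ-≤ r small₂)) ⟩
  s * s + (s * s + s * r)                                ≤⟨ ℕ.m≤m+n _ (3 * (s * r) + 2 * (r * r)) ⟩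
  s * s + (s * s + s * r) + (3 * (s * r) + 2 * (r * r))  ≡⟨ complete s r ⟩
  2 * ((s + r) * (s + r))                                ≡⟨ cong (λ x → 2 * (x * x)) (♯-∪ S#R) ⟨
  2 * (♯ (S ∪ R) * ♯ (S ∪ R))                            ∎)
  where
  open ℕ.≤-Reasoning
  O = ord (side t G)
  s = ♯ S
  r = ♯ R
  small₂ : 2 * q * r ℕ.≤ s
  small₂ = ℕ.≤-trans (ℕ.*-monoˡ-≤ r (ℕ.*-monoˡ-≤ q {2} {4} (s≤s (s≤s z≤n)))) small
  collect : ∀ q x s r → 2 * (q * ((x + s * r) + (r * s + r * r))) ≡ 2 * q * x + (4 * q * r * s + 2 * q * r * r)
  collect = solve-∀
  complete : ∀ s r → s * s + (s * s + s * r) + (3 * (s * r) + 2 * (r * r)) ≡ 2 * ((s + r) * (s + r))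
  complete = solve-∀

cls : ∀ {k} → (Fin n → Fin k) → VSet n → Fin k → VSet n
cls c P a v = P v ∧ (c v Fin≡ᵇ a)

suc-Fin≡ᵇ : (i j : Fin n) → (suc i Fin≡ᵇ suc j) ≡ (i Fin≡ᵇ j)
suc-Fin≡ᵇ i j = trans (isYes≗does (toℕ (suc i) ℕ.≟ toℕ (suc j))) (sym (isYes≗does (toℕ i ℕ.≟ toℕ j)))

skip₁ : Fin (suc n) → Fin (suc (suc n))
skip₁ zero = zero
skip₁ (suc a) = suc (suc a)

-- Colour one is freed for the newly removed set; zero stays with the leftover vertices and all
-- other colours move up.
recolour : Bool → Fin (suc n) → Fin (suc (suc n))
recolour s x = if s then suc zero else skip₁ x

recolour₀ : ∀ p s (x : Fin (suc n)) → p ∧ (recolour s x Fin≡ᵇ zero) ≡ (p ∧ not s) ∧ (x Fin≡ᵇ zero)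
recolour₀ false _     _       = refl
recolour₀ true  true  _       = refl
recolour₀ true  false zero    = refl
recolour₀ true  false (suc _) = refl

recolour₁ : ∀ p s (x : Fin (suc n)) → (s ≡ true → p ≡ true) → s ≡ p ∧ (recolour s x Fin≡ᵇ suc zero)
recolour₁ true  true  _       _ = refl
recolour₁ false true  _       f = sym (f refl)
recolour₁ true  false zero    _ = refl
recolour₁ true  false (suc _) _ = refl
recolour₁ false false _       _ = refl

recolour₂ : ∀ p s (x : Fin (suc n)) a →
  (p ∧ not s) ∧ (x Fin≡ᵇ suc a) ≡ p ∧ (recolour s x Fin≡ᵇ suc (suc a))
recolour₂ false _     _       a = refl
recolour₂ true  true  _       a = refl
recolour₂ true  false zero    a = refl
recolour₂ true  false (suc b) a = sym (suc-Fin≡ᵇ (suc b) (suc a))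

-- Colour zero is kept for the leftover vertices, which are too few to matter.
greedy : {H : Graph h} (q D : ℕ) → FindsRestricted H (2 * q) D → (G : Graph n) → Free H G →
  ∀ s t (P : VSet n) → D * (4 * q) * ♯ P ℕ.≤ t * s →
  Σ (Fin n → Fin (suc t)) λ c → (4 * q * ♯ (cls c P zero) ℕ.≤ s) × (∀ a → Restricted q G (cls c P (suc a)))
greedy {n = n} {H = H} q D finds G free s t P few with 4 * q * ♯ P ℕ.≤? s
... | yes small = (λ _ → zero)
  , ℕ.≤-trans (ℕ.*-monoʳ-≤ (4 * q) (♯-mono λ v → proj₁ ∘ ∧-true (P v) _)) small
  , λ a → Restricted-cong q G (λ v → sym (𝔹.∧-zeroʳ (P v))) (Restricted-∅ q G)
... | no large = step t few
  where
  open ℕ.≤-Reasoning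
  found = restricted-within {H = H} (2 * q) D finds G free P
  S = proj₁ found
  S⊆P = proj₁ (proj₂ found)
  4q♯P≤ : 4 * q * ♯ P ℕ.≤ D * (4 * q) * ♯ S
  4q♯P≤ = begin
    4 * q * ♯ P          ≤⟨ ℕ.*-monoʳ-≤ (4 * q) (proj₂ (proj₂ (proj₂ found))) ⟩
    4 * q * (D * ♯ S)    ≡⟨ rearrange q D (♯ S) ⟩
    D * (4 * q) * ♯ S    ∎
    where
    rearrange : ∀ q D x → 4 * q * (D * x) ≡ D * (4 * q) * x
    rearrange = solve-∀
  -- While the leftover is too large, removing `S` lowers `D * (4 * q) * ♯ P` by at least `s`. So
  -- `t` bounds the number of rounds still to come.
  s≤ : s ℕ.≤ D * (4 * q) * ♯ S
  s≤ = ℕ.≤-trans (ℕ.<⇒≤ (ℕ.≰⇒> large)) 4q♯P≤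
  step : ∀ t → D * (4 * q) * ♯ P ℕ.≤ t * s → Σ (Fin n → Fin (suc t)) λ c →
    (4 * q * ♯ (cls c P zero) ℕ.≤ s) × (∀ a → Restricted q G (cls c P (suc a)))
  -- With no rounds left the potential is zero, so `P` would have passed the smallness test.
  step zero few = contradiction (begin
    4 * q * ♯ P          ≤⟨ 4q♯P≤ ⟩
    D * (4 * q) * ♯ S    ≤⟨ ℕ.*-monoʳ-≤ (D * (4 * q)) (♯-mono S⊆P) ⟩
    D * (4 * q) * ♯ P    ≤⟨ few ⟩
    0                    ≤⟨ z≤n ⟩
    s                    ∎) large
  step (suc t) few = c
    , ℕ.≤-trans (ℕ.≤-reflexive (cong (4 * q *_) (♯-cong class₀))) (proj₁ (proj₂ rec))
    , λ { zero → Restricted-cong q G class₁ (Restricted-weaken q G (proj₁ (proj₂ (proj₂ found))))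
        ; (suc a) → Restricted-cong q G (class₂ a) (proj₂ (proj₂ rec) a) }
    where
    few′ : D * (4 * q) * ♯ (P ∖ S) ℕ.≤ t * s
    few′ = ℕ.+-cancelˡ-≤ s _ _ (begin
      s + D * (4 * q) * ♯ (P ∖ S)                      ≤⟨ ℕ.+-monoˡ-≤ _ s≤ ⟩
      D * (4 * q) * ♯ S + D * (4 * q) * ♯ (P ∖ S)      ≡⟨ ℕ.*-distribˡ-+ (D * (4 * q)) (♯ S) (♯ (P ∖ S)) ⟨
      D * (4 * q) * (♯ S + ♯ (P ∖ S))                  ≡⟨ cong (D * (4 * q) *_) (♯-∖ S⊆P) ⟨
      D * (4 * q) * ♯ P                                ≤⟨ few ⟩
      s + t * s                                        ∎)
    rec = greedy {H = H} q D finds G free s t (P ∖ S) few′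
    c′ = proj₁ rec
    c : Fin n → Fin (suc (suc t))
    c v = recolour (S v) (c′ v)
    class₀ : cls c P zero ≗ cls c′ (P ∖ S) zero
    class₀ v = recolour₀ (P v) (S v) (c′ v)
    class₁ : S ≗ cls c P (suc zero)
    class₁ v = recolour₁ (P v) (S v) (c′ v) (S⊆P v)
    class₂ : ∀ a → cls c′ (P ∖ S) (suc a) ≗ cls c P (suc (suc a))
    class₂ a v = recolour₂ (P v) (S v) (c′ v) a

RestrictedColouring : ℕ → Graph n → ℕ → Set
RestrictedColouring {n} q G k =
  Σ (Fin n → Fin k) λ c → ∀ a → Restricted q G (λ v → c v Fin≡ᵇ a)

-- The first set `S` fixes the threshold `s = ♯ S`. Since n ≤ D ♯S, `D * (4 * q) * D` rounds exhaust
-- the rest, and the leftover joins `S` in colour zero.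
restricted-colouring : {H : Graph h} (q D : ℕ) → FindsRestricted H (2 * q) D →
  (G : Graph n) → Free H G → RestrictedColouring q G (suc (D * (4 * q) * D))
restricted-colouring {n = n} {H = H} q D finds G free = c , classes
  where
  open ℕ.≤-Reasoning
  found = finds G free
  S = proj₁ found
  R : VSet n
  R v = not (S v)
  few : D * (4 * q) * ♯ R ℕ.≤ D * (4 * q) * D * ♯ S
  few = begin
    D * (4 * q) * ♯ R          ≤⟨ ℕ.*-monoʳ-≤ (D * (4 * q)) (ℕ.≤-trans (♯≤n R) (proj₂ (proj₂ found))) ⟩
    D * (4 * q) * (D * ♯ S)    ≡⟨ ℕ.*-assoc (D * (4 * q)) D (♯ S) ⟨
    D * (4 * q) * D * ♯ S      ∎
  rest = greedy {H = H} q D finds G free (♯ S) (D * (4 * q) * D) R few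
  c′ = proj₁ rest
  c : Fin n → Fin (suc (D * (4 * q) * D))
  c v = if S v then zero else c′ v
  S#leftover : S # cls c′ R zero
  S#leftover v p q with S v
  S#leftover v p () | true
  class₀ : S ∪ cls c′ R zero ≗ λ v → c v Fin≡ᵇ zero
  class₀ v with S v
  ... | true = refl
  ... | false = refl
  class₁ : ∀ a → cls c′ R (suc a) ≗ λ v → c v Fin≡ᵇ suc a
  class₁ a v with S v
  ... | true = refl
  ... | false = refl
  classes : ∀ a → Restricted q G (λ v → c v Fin≡ᵇ a)
  classes zero = Restricted-cong q G class₀
    (Restricted-∪ q G S#leftover (proj₁ (proj₂ rest)) (proj₁ (proj₂ found)))
  classes (suc a) = Restricted-cong q G (class₁ a) (proj₂ (proj₂ rest) a)

-- Vertex sets as boolean vectors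

list-sum-tabulate : (f : Fin n → ℕ) → List.sum (List.tabulate f) ≡ sum f
list-sum-tabulate {zero} f = refl
list-sum-tabulate {suc n} f = cong (f zero ℕ.+_) (list-sum-tabulate (f ∘ suc))

list-sum-concat : (f : Fin n → List.List ℕ) →
  List.sum (List.concat (List.tabulate f)) ≡ sum (List.sum ∘ f)
list-sum-concat {zero} f = refl
list-sum-concat {suc n} f = trans (List.sum-++ (f zero) _)
  (cong (List.sum (f zero) ℕ.+_) (list-sum-concat (f ∘ suc)))

edges≡e : (G : Graph n) (S : Subset n) → edges G S ≡ e (ord (adj G)) (lookup S) (lookup S)
edges≡e {n} G S = trans (cong (List.sum ∘ List.concat) (List.map-tabulate id row))
  (trans (list-sum-concat row)
    (sum-cong-≗ λ i → trans (cong List.sum (List.map-tabulate id (entry i)))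
      (trans (list-sum-tabulate (entry i))
        (sum-cong-≗ λ j → cong bool→ℕ (rotate ⌊ toℕ i ℕ.<? toℕ j ⌋ (lookup S i) (lookup S j))))))
  where
  entry : Fin n → Fin n → ℕ
  entry i j = bool→ℕ (⌊ toℕ i ℕ.<? toℕ j ⌋ ∧ lookup S i ∧ lookup S j ∧ adj G i j)
  row : Fin n → List.List ℕ
  row i = List.map (entry i) (List.allFin n)
  rotate : ∀ a b c {d} → a ∧ b ∧ c ∧ d ≡ b ∧ c ∧ a ∧ d
  rotate true  true  true  = refl
  rotate true  true  false = refl
  rotate true  false _     = refl
  rotate false true  true  = refl
  rotate false true  false = refl
  rotate false false _     = refl

∣∣≡♯ : (S : Subset n) → ∣ S ∣ ≡ ♯ (lookup S)
∣∣≡♯ [] = refl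
∣∣≡♯ (true ∷ S) = cong suc (∣∣≡♯ S)
∣∣≡♯ (false ∷ S) = ∣∣≡♯ S

-- Rational numbers

-- Division by 1 normalises through a gcd that is stuck on a variable `k`; the explicit form exposes
-- the integer order and product.
ℕ→ℚ≡mkℚ : ∀ k → ℕ→ℚ k ≡ mkℚ (+ k) 0 (coprime-sym (1-coprimeTo k))
ℕ→ℚ≡mkℚ k = ℚ.normalize-coprime (coprime-sym (1-coprimeTo k))

ℕ→ℚ-mono : ∀ {a b} → a ℕ.≤ b → ℕ→ℚ a ≤ ℕ→ℚ b
ℕ→ℚ-mono {a} {b} a≤b rewrite ℕ→ℚ≡mkℚ a | ℕ→ℚ≡mkℚ b =
  ℚ.*≤* (ℤ.*-monoʳ-≤-nonNeg (+ 1) (ℤ.+≤+ a≤b))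

ℕ→ℚ-reflect : ∀ {a b} → ℕ→ℚ a ≤ ℕ→ℚ b → a ℕ.≤ b
ℕ→ℚ-reflect {a} {b} a≤b rewrite ℕ→ℚ≡mkℚ a | ℕ→ℚ≡mkℚ b =
  ℤ.drop‿+≤+ (ℤ.*-cancelʳ-≤-pos (+ a) (+ b) (+ 1) (ℚ.drop-*≤* a≤b))

ℕ→ℚ-* : ∀ a b → ℕ→ℚ (a * b) ≡ ℕ→ℚ a ℚ.* ℕ→ℚ b
ℕ→ℚ-* a b rewrite ℕ→ℚ≡mkℚ a | ℕ→ℚ≡mkℚ b = cong (_/ 1) (ℤ.pos-* a b)

0≤ℕ→ℚ : ∀ k → 0ℚ ≤ ℕ→ℚ k
0≤ℕ→ℚ k = ℕ→ℚ-mono {0} {k} z≤n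

ℕ→ℚ-^ : ∀ a k → ℕ→ℚ (a ^ k) ≡ ℕ→ℚ a ^ℚ k
ℕ→ℚ-^ a zero = refl
ℕ→ℚ-^ a (suc k) = trans (ℕ→ℚ-* a (a ^ k)) (cong (ℕ→ℚ a ℚ.*_) (ℕ→ℚ-^ a k))

ℚ-*-monoˡ : ∀ {r p q} → 0ℚ ≤ r → p ≤ q → r ℚ.* p ≤ r ℚ.* q
ℚ-*-monoˡ {r} 0≤r = ℚ.*-monoˡ-≤-nonNeg r ⦃ ℚ.nonNegative 0≤r ⦄

ℚ-*-monoʳ : ∀ {r p q} → 0ℚ ≤ r → p ≤ q → p ℚ.* r ≤ q ℚ.* r
ℚ-*-monoʳ {r} 0≤r = ℚ.*-monoʳ-≤-nonNeg r ⦃ ℚ.nonNegative 0≤r ⦄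

ℚ-*-mono : ∀ {p q r s} → 0ℚ ≤ q → 0ℚ ≤ r → p ≤ q → r ≤ s → p ℚ.* r ≤ q ℚ.* s
ℚ-*-mono 0≤q 0≤r p≤q r≤s = ℚ.≤-trans (ℚ-*-monoʳ 0≤r p≤q) (ℚ-*-monoˡ 0≤q r≤s)

0≤* : ∀ {p q} → 0ℚ ≤ p → 0ℚ ≤ q → 0ℚ ≤ p ℚ.* q
0≤* {p} 0≤p 0≤q = ℚ.≤-trans (ℚ.≤-reflexive (sym (ℚ.*-zeroʳ p))) (ℚ-*-monoˡ 0≤p 0≤q)

0≤^ : ∀ {p} k → 0ℚ ≤ p → 0ℚ ≤ p ^ℚ k
0≤^ zero 0≤p = 0≤ℕ→ℚ 1
0≤^ (suc k) 0≤p = 0≤* 0≤p (0≤^ k 0≤p)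

^ℚ-mono : ∀ {p q} k → 0ℚ ≤ p → p ≤ q → p ^ℚ k ≤ q ^ℚ k
^ℚ-mono zero 0≤p p≤q = ℚ.≤-refl
^ℚ-mono (suc k) 0≤p p≤q = ℚ-*-mono (ℚ.≤-trans 0≤p p≤q) (0≤^ k 0≤p) p≤q (^ℚ-mono k 0≤p p≤q)

ℚ-*-interchange : ∀ a b c d → (a ℚ.* b) ℚ.* (c ℚ.* d) ≡ (a ℚ.* c) ℚ.* (b ℚ.* d)
ℚ-*-interchange = interchange

^ℚ-distrib-* : ∀ p q k → (p ℚ.* q) ^ℚ k ≡ (p ^ℚ k) ℚ.* (q ^ℚ k)
^ℚ-distrib-* p q zero = refl
^ℚ-distrib-* p q (suc k) = trans (cong ((p ℚ.* q) ℚ.*_) (^ℚ-distrib-* p q k))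
  (ℚ-*-interchange p q (p ^ℚ k) (q ^ℚ k))

1^ℚ : ∀ k → 1ℚ ^ℚ k ≡ 1ℚ
1^ℚ zero = refl
1^ℚ (suc k) = trans (ℚ.*-identityˡ (1ℚ ^ℚ k)) (1^ℚ k)

^ℚ-+ : ∀ p j k → p ^ℚ (j + k) ≡ (p ^ℚ j) ℚ.* (p ^ℚ k)
^ℚ-+ p zero k = sym (ℚ.*-identityˡ (p ^ℚ k))
^ℚ-+ p (suc j) k = trans (cong (p ℚ.*_) (^ℚ-+ p j k)) (sym (ℚ.*-assoc p (p ^ℚ j) (p ^ℚ k)))

^ℚ-* : ∀ p j k → (p ^ℚ j) ^ℚ k ≡ p ^ℚ (k * j)
^ℚ-* p j zero = refl
^ℚ-* p j (suc k) = trans (cong ((p ^ℚ j) ℚ.*_) (^ℚ-* p j k)) (sym (^ℚ-+ p j (k * j)))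

*-denominator : ∀ p d .(c : Coprime p (suc d)) → mkℚ (+ p) d c ℚ.* ℕ→ℚ (suc d) ≡ ℕ→ℚ p
*-denominator p d c rewrite ℕ→ℚ≡mkℚ (suc d) = ℚ.toℚᵘ-injective
  (ℚᵘ.≃-trans (ℚ.toℚᵘ-homo-* (mkℚ (+ p) d c) (mkℚ +[1+ d ] 0 (coprime-sym (1-coprimeTo (suc d)))))
    (ℚᵘ.≃-trans (ℚᵘ.*≡* eq) (ℚᵘ.≃-sym (ℚ.toℚᵘ-fromℚᵘ (ℚᵘ.mkℚᵘ (+ p) 0)))))
  where
  eq : + p ℤ.* +[1+ d ] ℤ.* + 1 ≡ + p ℤ.* + (suc d * 1)
  eq = trans (ℤ.*-identityʳ (+ p ℤ.* +[1+ d ])) (cong (λ x → + p ℤ.* + x) (sym (ℕ.*-identityʳ (suc d))))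

-- suc r is 1/ε rounded down, plus one.
reciprocal : ∀ ε → 0ℚ < ε → Σ ℕ λ r → 1ℚ ≤ ε ℚ.* ℕ→ℚ (suc r) × (ε ≤ 1ℚ → ε ℚ.* ℕ→ℚ (suc r) ≤ ℕ→ℚ 2)
reciprocal (mkℚ (+ zero) d c) (ℚ.*<* (ℤ.+<+ ()))
reciprocal ε@(mkℚ +[1+ p-1 ] d c) _ = r , lower , upper
  where
  open ℚ.≤-Reasoning
  p = suc p-1
  D = suc d
  r = D ℕ./ p
  scaled : ∀ k → ℕ→ℚ D ℚ.* (ε ℚ.* ℕ→ℚ k) ≡ ℕ→ℚ (p * k)
  scaled k = trans (sym (ℚ.*-assoc (ℕ→ℚ D) ε (ℕ→ℚ k)))
    (trans (cong (ℚ._* ℕ→ℚ k) (trans (ℚ.*-comm (ℕ→ℚ D) ε) (*-denominator p d c))) (sym (ℕ→ℚ-* p k)))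
  instance
    D>0 : ℚ.Positive (ℕ→ℚ D)
    D>0 = subst ℚ.Positive (sym (ℕ→ℚ≡mkℚ D)) _
  D≤ : D ℕ.≤ p * suc r
  D≤ = ℕ.≤-trans (ℕ.≤-reflexive (ℕ.m≡m%n+[m/n]*n D p))
    (ℕ.≤-trans (ℕ.+-monoˡ-≤ (r * p) (ℕ.<⇒≤ (ℕ.m%n<n D p))) (ℕ.≤-reflexive (ℕ.*-comm (suc r) p)))
  lower : 1ℚ ≤ ε ℚ.* ℕ→ℚ (suc r)
  lower = ℚ.*-cancelˡ-≤-pos (ℕ→ℚ D) (begin
    ℕ→ℚ D ℚ.* 1ℚ                    ≡⟨ ℚ.*-identityʳ (ℕ→ℚ D) ⟩
    ℕ→ℚ D                           ≤⟨ ℕ→ℚ-mono D≤ ⟩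
    ℕ→ℚ (p * suc r)                 ≡⟨ scaled (suc r) ⟨
    ℕ→ℚ D ℚ.* (ε ℚ.* ℕ→ℚ (suc r))   ∎)
  -- For ε = p/D at most 1, p (r + 1) = p + p r ≤ D + D.
  upper : ε ≤ 1ℚ → ε ℚ.* ℕ→ℚ (suc r) ≤ ℕ→ℚ 2
  upper ε≤1 = ℚ.*-cancelˡ-≤-pos (ℕ→ℚ D) (begin
    ℕ→ℚ D ℚ.* (ε ℚ.* ℕ→ℚ (suc r))   ≡⟨ scaled (suc r) ⟩
    ℕ→ℚ (p * suc r)                 ≤⟨ ℕ→ℚ-mono p*q≤ ⟩
    ℕ→ℚ (D * 2)                     ≡⟨ ℕ→ℚ-* D 2 ⟩
    ℕ→ℚ D ℚ.* ℕ→ℚ 2                 ∎)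
    where
    p≤D : p ℕ.≤ D
    p≤D = ℕ→ℚ-reflect (begin
      ℕ→ℚ p            ≡⟨ *-denominator p d c ⟨
      ε ℚ.* ℕ→ℚ D      ≤⟨ ℚ-*-monoʳ (0≤ℕ→ℚ D) ε≤1 ⟩
      1ℚ ℚ.* ℕ→ℚ D     ≡⟨ ℚ.*-identityˡ (ℕ→ℚ D) ⟩
      ℕ→ℚ D            ∎)
    p*q≤ : p * suc r ℕ.≤ D * 2
    p*q≤ = ℕ.≤-trans (ℕ.≤-reflexive (ℕ.*-comm p (suc r)))
      (ℕ.≤-trans (ℕ.+-mono-≤ p≤D (ℕ.m/n*n≤m D p)) (ℕ.≤-reflexive (twice D)))
      where
      twice : ∀ D → D + D ≡ D * 2
      twice = solve-∀

-- Translation between rational and natural bounds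

nat-bound : ∀ ε z a b → ε ℚ.* ℕ→ℚ z ≡ 1ℚ → ℕ→ℚ a ≤ ε ℚ.* ℕ→ℚ b → z * a ℕ.≤ b
nat-bound ε z a b εz≡1 a≤ = ℕ→ℚ-reflect (begin
  ℕ→ℚ (z * a)                  ≡⟨ ℕ→ℚ-* z a ⟩
  ℕ→ℚ z ℚ.* ℕ→ℚ a              ≤⟨ ℚ-*-monoˡ (0≤ℕ→ℚ z) a≤ ⟩
  ℕ→ℚ z ℚ.* (ε ℚ.* ℕ→ℚ b)      ≡⟨ ℚ.*-assoc (ℕ→ℚ z) ε (ℕ→ℚ b) ⟨
  (ℕ→ℚ z ℚ.* ε) ℚ.* ℕ→ℚ b      ≡⟨ cong (ℚ._* ℕ→ℚ b) (trans (ℚ.*-comm (ℕ→ℚ z) ε) εz≡1) ⟩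
  1ℚ ℚ.* ℕ→ℚ b                 ≡⟨ ℚ.*-identityˡ (ℕ→ℚ b) ⟩
  ℕ→ℚ b                        ∎)
  where open ℚ.≤-Reasoning

-- As q ≥ 1/ε, the bound with 1/q is the stronger one; thus arbitrary ε reduce to unit fractions.
rational-bound : ∀ {ε} q a b → 0ℚ ≤ ε → 1ℚ ≤ ε ℚ.* ℕ→ℚ q → q * a ℕ.≤ b → ℕ→ℚ a ≤ ε ℚ.* ℕ→ℚ b
rational-bound {ε} q a b 0≤ε 1≤εq qa≤b = begin
  ℕ→ℚ a                        ≡⟨ ℚ.*-identityˡ (ℕ→ℚ a) ⟨
  1ℚ ℚ.* ℕ→ℚ a                 ≤⟨ ℚ-*-monoʳ (0≤ℕ→ℚ a) 1≤εq ⟩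
  (ε ℚ.* ℕ→ℚ q) ℚ.* ℕ→ℚ a      ≡⟨ ℚ.*-assoc ε (ℕ→ℚ q) (ℕ→ℚ a) ⟩
  ε ℚ.* (ℕ→ℚ q ℚ.* ℕ→ℚ a)      ≡⟨ cong (ε ℚ.*_) (ℕ→ℚ-* q a) ⟨
  ε ℚ.* ℕ→ℚ (q * a)            ≤⟨ ℚ-*-monoˡ 0≤ε (ℕ→ℚ-mono qa≤b) ⟩
  ε ℚ.* ℕ→ℚ b                  ∎
  where open ℚ.≤-Reasoning

side-edges : Bool → Graph n → Subset n → ℕ
side-edges true G = edges G
side-edges false G = edges (complement G)

side-edges≡e : ∀ t (G : Graph n) (S : Subset n) → side-edges t G S ≡ e (ord (side t G)) (lookup S) (lookup S)
side-edges≡e true G = edges≡e G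
side-edges≡e false G = edges≡e (complement G)

Weakly⇒Restricted : ∀ ε z (G : Graph n) (S : Subset n) → ε ℚ.* ℕ→ℚ z ≡ 1ℚ →
  WeaklyRestricted ε G S → Restricted z G (lookup S)
Weakly⇒Restricted ε z G S εz≡1 = [ (λ p → true , sparse true p) , (λ p → false , sparse false p) ]′
  where
  sparse : ∀ t → ℕ→ℚ (side-edges t G S) ≤ ε ℚ.* ℕ→ℚ (∣ S ∣ * ∣ S ∣) → Sparse z (side t G) (lookup S)
  sparse t p = subst₂ (λ x y → z * x ℕ.≤ y * y) (side-edges≡e t G S) (∣∣≡♯ S) (nat-bound ε z _ _ εz≡1 p)

Restricted⇒Weakly : ∀ {ε} q (G : Graph n) (S : Subset n) → 0ℚ ≤ ε → 1ℚ ≤ ε ℚ.* ℕ→ℚ q →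
  Restricted q G (lookup S) → WeaklyRestricted ε G S
Restricted⇒Weakly {n} {ε} q G S 0≤ε 1≤εq (t , sparse) = weak t (rational-bound q _ _ 0≤ε 1≤εq
  (subst₂ (λ x y → q * x ℕ.≤ y * y) (sym (side-edges≡e t G S)) (sym (∣∣≡♯ S)) sparse))
  where
  weak : ∀ t → ℕ→ℚ (side-edges t G S) ≤ ε ℚ.* ℕ→ℚ (∣ S ∣ * ∣ S ∣) → WeaklyRestricted ε G S
  weak true = inj₁
  weak false = inj₂

colouring⇒partition : ∀ {ε} q (G : Graph n) {k} → 0ℚ ≤ ε → 1ℚ ≤ ε ℚ.* ℕ→ℚ q →
  RestrictedColouring q G k → RestrictedPartition ε G k
colouring⇒partition q G 0≤ε 1≤εq (c , classes) = c , λ a →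
  Restricted⇒Weakly q G (classOf c a) 0≤ε 1≤εq
    (Restricted-cong q G (λ v → sym (Vec.lookup∘tabulate (λ v → c v Fin≡ᵇ a) v)) (classes a))

partition-exists : (H : Graph h) (ε : ℚ) → 0ℚ < ε → Σ ℕ λ N → (N ≥ 1) ×
  (∀ {n} (G : Graph n) → Free H G → Σ ℕ λ k → (k ℕ.≤ N) × RestrictedPartition ε G k)
partition-exists H ε ε>0 = N , s≤s z≤n , λ G free → N , ℕ.≤-refl ,
  colouring⇒partition q G (ℚ.<⇒≤ ε>0) (proj₁ (proj₂ approx))
    (restricted-colouring {H = H} q D (proj₂ rödl) G free)
  where
  approx = reciprocal ε ε>0
  q = suc (proj₁ approx)
  -- Twice `q`, because absorbing the leftover halves the parameter.
  rödl = large-restricted-set H (2 * q) (s≤s z≤n)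
  D = proj₁ rödl
  N = suc (D * (4 * q) * D)

-- Polynomial dependence

PolyPartition : Graph h → Set
PolyPartition H = Σ ℕ λ C → (0 ℕ.< C) ×
  (∀ (ε : ℚ) (ε>0 : 0ℚ < ε) → ε ≤ (+ 1) / 2 → ∀ {n} (G : Graph n) → Free H G →
    Σ ℕ λ k → (ℕ→ℚ k ≤ ((1/ ε) {{pos⇒nonZero ε {{positive ε>0}}}}) ^ℚ C) × RestrictedPartition ε G k)

½≤1 : (+ 1) / 2 ≤ 1ℚ
½≤1 = ℚ.*≤* (ℤ.+≤+ (s≤s z≤n))

-- The hypothesis is applied to the unit fraction 1/z with z = 2(r + 1), which is at most 1/2; its
-- proportion (1/z)^C becomes the constant z^C.
PolyRödl⇒FindsRestricted : (H : Graph h) (rödl : PolyRödl H) → ∀ r →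
  FindsRestricted H (2 * suc r) ((2 * suc r) ^ proj₁ rödl)
PolyRödl⇒FindsRestricted H (C , _ , find) r {n} G free = lookup S
  , Weakly⇒Restricted ε z G S εz≡1 (proj₁ (proj₂ found))
  , ℕ→ℚ-reflect (begin
    ℕ→ℚ n                                          ≡⟨ ℚ.*-identityˡ (ℕ→ℚ n) ⟨
    1ℚ ℚ.* ℕ→ℚ n                                   ≡⟨ cong (ℚ._* ℕ→ℚ n) zC*εC≡1 ⟨
    (ℕ→ℚ (z ^ C) ℚ.* (ε ^ℚ C)) ℚ.* ℕ→ℚ n           ≡⟨ ℚ.*-assoc (ℕ→ℚ (z ^ C)) (ε ^ℚ C) (ℕ→ℚ n) ⟩
    ℕ→ℚ (z ^ C) ℚ.* ((ε ^ℚ C) ℚ.* ℕ→ℚ n)           ≤⟨ ℚ-*-monoˡ (0≤ℕ→ℚ (z ^ C)) (proj₂ (proj₂ found)) ⟩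
    ℕ→ℚ (z ^ C) ℚ.* ℕ→ℚ ∣ S ∣                      ≡⟨ ℕ→ℚ-* (z ^ C) ∣ S ∣ ⟨
    ℕ→ℚ (z ^ C * ∣ S ∣)                            ≡⟨ cong (λ x → ℕ→ℚ (z ^ C * x)) (∣∣≡♯ S) ⟩
    ℕ→ℚ (z ^ C * ♯ (lookup S))                     ∎)
  where
  open ℚ.≤-Reasoning
  z = 2 * suc r
  ε : ℚ
  -- `mkℚ` stores the denominator minus one; this is the form to which the predecessor of
  -- `2 * suc r` computes.
  ε = mkℚ (+ 1) (r + (suc r + 0)) (1-coprimeTo z)
  εz≡1 : ε ℚ.* ℕ→ℚ z ≡ 1ℚ
  εz≡1 = *-denominator 1 (r + (suc r + 0)) (1-coprimeTo z)
  ε≤½ : ε ≤ (+ 1) / 2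
  ε≤½ = ℚ.*≤* (ℤ.+≤+ (s≤s (ℕ.≤-trans (s≤s z≤n) (ℕ.≤-reflexive (shift r)))))
    where
    shift : ∀ r → suc (r + r) ≡ r + (suc r + 0) + 0
    shift = solve-∀
  found = find ε (ℚ.positive⁻¹ ε) ε≤½ G free
  S = proj₁ found
  zC*εC≡1 : ℕ→ℚ (z ^ C) ℚ.* (ε ^ℚ C) ≡ 1ℚ
  zC*εC≡1 = trans (cong (ℚ._* (ε ^ℚ C)) (ℕ→ℚ-^ z C))
    (trans (sym (^ℚ-distrib-* (ℕ→ℚ z) ε C))
      (trans (cong (_^ℚ C) (trans (ℚ.*-comm (ℕ→ℚ z) ε) εz≡1)) (1^ℚ C)))

-- With z = 2q and D = z^C, the number of colours is 1 + 2zD² ≤ 1 + z²D² ≤ 2z²D² ≤ z³D², using z ≥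
-- 2.
colours≤power : ∀ q C → 1 ℕ.≤ q →
  suc ((2 * q) ^ C * (4 * q) * (2 * q) ^ C) ℕ.≤ (2 * q) ^ (3 + (C + C))
colours≤power q C q≥1 = begin
  suc (D * (4 * q) * D)      ≡⟨ cong suc (rearrange D q) ⟩
  suc (2 * (z * (D * D)))    ≤⟨ s≤s (ℕ.*-monoˡ-≤ (z * (D * D)) z≥2) ⟩
  suc y                      ≤⟨ ℕ.+-monoˡ-≤ y y≥1 ⟩
  y + y                      ≡⟨ cong (λ x → y + x) (ℕ.+-identityʳ y) ⟨
  2 * y                      ≤⟨ ℕ.*-monoˡ-≤ y z≥2 ⟩
  z * y                      ≡⟨ cong (λ x → z * (z * (z * x))) (ℕ.^-distribˡ-+-* z C C) ⟨
  z ^ (3 + (C + C))          ∎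
  where
  open ℕ.≤-Reasoning
  z = 2 * q
  D = z ^ C
  y = z * (z * (D * D))
  z≥2 : 2 ℕ.≤ z
  z≥2 = ℕ.*-monoʳ-≤ 2 q≥1
  z≥1 : 1 ℕ.≤ z
  z≥1 = ℕ.≤-trans (s≤s z≤n) z≥2
  D≥1 : 1 ℕ.≤ D
  D≥1 = ℕ.m^n>0 z ⦃ ℕ.>-nonZero z≥1 ⦄ C
  y≥1 : 1 ℕ.≤ y
  y≥1 = ℕ.*-mono-≤ z≥1 (ℕ.*-mono-≤ z≥1 (ℕ.*-mono-≤ D≥1 D≥1))
  rearrange : ∀ D q → D * (4 * q) * D ≡ 2 * (2 * q * (D * D))
  rearrange = solve-∀

-- Here x = 1/ε is at least 2 and q ≤ 2x, so 2q ≤ 4x ≤ x³.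
double-reciprocal≤cube : ∀ {ε x} q → 0ℚ ≤ x → ε ≤ (+ 1) / 2 → ε ℚ.* x ≡ 1ℚ →
  ε ℚ.* ℕ→ℚ q ≤ ℕ→ℚ 2 → ℕ→ℚ (2 * q) ≤ x ^ℚ 3
double-reciprocal≤cube {ε} {x} q 0≤x ε≤½ εx≡1 εq≤2 = begin
  ℕ→ℚ (2 * q)                          ≡⟨ ℕ→ℚ-* 2 q ⟩
  ℕ→ℚ 2 ℚ.* ℕ→ℚ q                      ≡⟨ cong (ℕ→ℚ 2 ℚ.*_) q≡ ⟩
  ℕ→ℚ 2 ℚ.* ((ε ℚ.* ℕ→ℚ q) ℚ.* x)      ≤⟨ ℚ-*-mono 0≤x 0≤εqx 2≤x (ℚ-*-monoʳ 0≤x (ℚ.≤-trans εq≤2 2≤x)) ⟩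
  x ℚ.* (x ℚ.* x)                      ≡⟨ cong (λ y → x ℚ.* (x ℚ.* y)) (ℚ.*-identityʳ x) ⟨
  x ^ℚ 3                               ∎
  where
  open ℚ.≤-Reasoning
  q≡ : ℕ→ℚ q ≡ (ε ℚ.* ℕ→ℚ q) ℚ.* x
  q≡ = sym (trans (cong (ℚ._* x) (ℚ.*-comm ε (ℕ→ℚ q)))
    (trans (ℚ.*-assoc (ℕ→ℚ q) ε x) (trans (cong (ℕ→ℚ q ℚ.*_) εx≡1) (ℚ.*-identityʳ (ℕ→ℚ q)))))
  0≤εqx : 0ℚ ≤ (ε ℚ.* ℕ→ℚ q) ℚ.* x
  0≤εqx = subst (0ℚ ≤_) q≡ (0≤ℕ→ℚ q)
  2≤x : ℕ→ℚ 2 ≤ x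
  2≤x = begin
    ℕ→ℚ 2                          ≡⟨ ℚ.*-identityʳ (ℕ→ℚ 2) ⟨
    ℕ→ℚ 2 ℚ.* 1ℚ                   ≡⟨ cong (ℕ→ℚ 2 ℚ.*_) εx≡1 ⟨
    ℕ→ℚ 2 ℚ.* (ε ℚ.* x)            ≤⟨ ℚ-*-monoˡ (0≤ℕ→ℚ 2) (ℚ-*-monoʳ 0≤x ε≤½) ⟩
    ℕ→ℚ 2 ℚ.* ((+ 1) / 2 ℚ.* x)    ≡⟨ ℚ.*-assoc (ℕ→ℚ 2) ((+ 1) / 2) x ⟨
    1ℚ ℚ.* x                       ≡⟨ ℚ.*-identityˡ x ⟩
    x                              ∎

module Inverse (ε : ℚ) (ε>0 : 0ℚ < ε) where
  x : ℚ
  x = (1/ ε) {{pos⇒nonZero ε {{positive ε>0}}}}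

  εx≡1 : ε ℚ.* x ≡ 1ℚ
  εx≡1 = ℚ.*-inverseʳ ε {{pos⇒nonZero ε {{positive ε>0}}}}

  0≤x : 0ℚ ≤ x
  0≤x = ℚ.<⇒≤ (ℚ.positive⁻¹ x {{ℚ.1/pos⇒pos ε {{positive ε>0}}}})

PolyRödl⇒PolyPartition : (H : Graph h) → PolyRödl H → PolyPartition H
-- There are at most (2q)^E colours, and 2q ≤ (1/ε)³ turns the exponent into `E * 3`.
PolyRödl⇒PolyPartition H rödl@(C , _) = E * 3 , s≤s z≤n , partition
  where
  E = 3 + (C + C)
  partition : ∀ (ε : ℚ) (ε>0 : 0ℚ < ε) → ε ≤ (+ 1) / 2 → ∀ {n} (G : Graph n) → Free H G →
    Σ ℕ λ k → (ℕ→ℚ k ≤ ((1/ ε) {{pos⇒nonZero ε {{positive ε>0}}}}) ^ℚ (E * 3)) × RestrictedPartition ε G k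
  partition ε ε>0 ε≤½ G free = k , (begin
      ℕ→ℚ k                  ≤⟨ ℕ→ℚ-mono (colours≤power q C (s≤s z≤n)) ⟩
      ℕ→ℚ ((2 * q) ^ E)      ≡⟨ ℕ→ℚ-^ (2 * q) E ⟩
      ℕ→ℚ (2 * q) ^ℚ E       ≤⟨ ^ℚ-mono E (0≤ℕ→ℚ (2 * q)) (double-reciprocal≤cube q 0≤x ε≤½ εx≡1
                                  (proj₂ (proj₂ approx) (ℚ.≤-trans ε≤½ ½≤1))) ⟩
      (x ^ℚ 3) ^ℚ E          ≡⟨ ^ℚ-* x 3 E ⟩
      x ^ℚ (E * 3)           ∎)
    , colouring⇒partition q G (ℚ.<⇒≤ ε>0) (proj₁ (proj₂ approx))
        (restricted-colouring {H = H} q ((2 * q) ^ C) (PolyRödl⇒FindsRestricted H rödl (proj₁ approx)) G free)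
    where
    open ℚ.≤-Reasoning
    open Inverse ε ε>0
    approx = reciprocal ε ε>0
    q = suc (proj₁ approx)
    k = suc ((2 * q) ^ C * (4 * q) * (2 * q) ^ C)

Fin≡ᵇ-refl : (i : Fin n) → (i Fin≡ᵇ i) ≡ true
Fin≡ᵇ-refl i = trans (isYes≗does (toℕ i ℕ.≟ toℕ i)) (T⇒≡ (ℕ.≡⇒≡ᵇ (toℕ i) (toℕ i) refl))

-- Averaging: otherwise k times each class is at most n, and summing over the k classes gives (n +
-- 1) k ≤ k n. This is absurd because `k` is positive, vertex zero having a colour.
largest-class : ∀ {k} (c : Fin (suc n) → Fin k) → ∃ λ a → suc n ℕ.≤ k * ♯ (λ v → c v Fin≡ᵇ a)
largest-class {n} {k} c with 𝔽.any? (λ a → suc n ℕ.≤? k * ♯ (λ v → c v Fin≡ᵇ a))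
... | yes p = p
... | no none = contradiction (begin-strict
    suc n * k                                             ≤⟨ ℕ.*-monoˡ-≤ k covered ⟩
    (sum λ a → ♯ (class a)) * k                           ≡⟨ *-distribʳ-sum k (♯ ∘ class) ⟩
    (sum λ a → ♯ (class a) * k)                           ≡⟨ sum-cong-≗ (λ a → ℕ.*-comm (♯ (class a)) k) ⟩
    (sum λ a → k * ♯ (class a))                           ≤⟨ sum-mono (λ a → ℕ.s≤s⁻¹ (ℕ.≰⇒> λ p → none (a , p))) ⟩
    sum {k} (λ _ → n)                                     ≡⟨ sum-const k n ⟩
    k * n                                                 <⟨ ℕ.m<n+m (k * n) k>0 ⟩
    k + k * n                                             ≡⟨ ℕ.*-suc k n ⟨
    k * suc n                                             ≡⟨ ℕ.*-comm k (suc n) ⟩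
    suc n * k                                             ∎) (ℕ.<-irrefl refl)
  where
  open ℕ.≤-Reasoning
  class : Fin k → VSet (suc n)
  class a v = c v Fin≡ᵇ a
  k>0 : 0 ℕ.< k
  k>0 = ℕ.≤-trans (s≤s z≤n) (𝔽.toℕ<n (c zero))
  covered : suc n ℕ.≤ (sum λ a → ♯ (class a))
  covered = begin
    suc n                                          ≡⟨ ℕ.*-identityʳ (suc n) ⟨
    suc n * 1                                      ≡⟨ sum-const (suc n) 1 ⟨
    sum {suc n} (λ _ → 1)                          ≤⟨ sum-mono (λ v → ℕ.≤-trans
      (ℕ.≤-reflexive (cong bool→ℕ (sym (Fin≡ᵇ-refl (c v))))) (term≤sum (λ a → bool→ℕ (class a v)) (c v))) ⟩
    (sum λ v → sum λ a → bool→ℕ (class a v))       ≡⟨ ∑-comm (λ v a → bool→ℕ (class a v)) ⟩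
    (sum λ a → ♯ (class a))                        ∎

-- The exponent is unchanged: the largest class satisfies n ≤ k ♯S with k ≤ (1/ε)^C, and multiplying
-- by ε^C cancels the power.
PolyPartition⇒PolyRödl : (H : Graph h) → PolyPartition H → PolyRödl H
PolyPartition⇒PolyRödl H (C , C>0 , partition) = C , C>0 , find
  where
  find : ∀ (ε : ℚ) → 0ℚ < ε → ε ≤ (+ 1) / 2 → ∀ {n} (G : Graph n) → Free H G →
    Σ (Subset n) λ S → WeaklyRestricted ε G S × ((ε ^ℚ C) ℚ.* ℕ→ℚ n ≤ ℕ→ℚ ∣ S ∣)
  -- Without vertices there may be no colour to choose, so the empty set is given directly.
  find ε ε>0 _ {zero} G _ = [] , inj₁ (ℚ.≤-reflexive (sym (ℚ.*-zeroʳ ε)))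
    , ℚ.≤-reflexive (ℚ.*-zeroʳ (ε ^ℚ C))
  find ε ε>0 ε≤½ {n@(suc _)} G free = S , proj₂ (proj₂ (proj₂ parts)) a , (begin
      (ε ^ℚ C) ℚ.* ℕ→ℚ n                         ≤⟨ ℚ-*-monoˡ 0≤εC (ℕ→ℚ-mono n≤) ⟩
      (ε ^ℚ C) ℚ.* ℕ→ℚ (k * ∣ S ∣)               ≡⟨ cong ((ε ^ℚ C) ℚ.*_) (ℕ→ℚ-* k ∣ S ∣) ⟩
      (ε ^ℚ C) ℚ.* (ℕ→ℚ k ℚ.* ℕ→ℚ ∣ S ∣)         ≤⟨ ℚ-*-monoˡ 0≤εC (ℚ-*-monoʳ (0≤ℕ→ℚ ∣ S ∣) (proj₁ (proj₂ parts))) ⟩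
      (ε ^ℚ C) ℚ.* ((x ^ℚ C) ℚ.* ℕ→ℚ ∣ S ∣)      ≡⟨ ℚ.*-assoc (ε ^ℚ C) (x ^ℚ C) (ℕ→ℚ ∣ S ∣) ⟨
      ((ε ^ℚ C) ℚ.* (x ^ℚ C)) ℚ.* ℕ→ℚ ∣ S ∣      ≡⟨ cong (ℚ._* ℕ→ℚ ∣ S ∣) εC*xC≡1 ⟩
      1ℚ ℚ.* ℕ→ℚ ∣ S ∣                           ≡⟨ ℚ.*-identityˡ (ℕ→ℚ ∣ S ∣) ⟩
      ℕ→ℚ ∣ S ∣                                  ∎)
    where
    open ℚ.≤-Reasoning
    open Inverse ε ε>0
    parts = partition ε ε>0 ε≤½ G free
    k = proj₁ parts
    c = proj₁ (proj₂ (proj₂ parts))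
    largest = largest-class c
    a = proj₁ largest
    S = classOf c a
    n≤ : n ℕ.≤ k * ∣ S ∣
    n≤ = ℕ.≤-trans (proj₂ largest) (ℕ.≤-reflexive (cong (k *_) (sym (trans (∣∣≡♯ S)
      (♯-cong (Vec.lookup∘tabulate (λ v → c v Fin≡ᵇ a)))))))
    0≤εC : 0ℚ ≤ ε ^ℚ C
    0≤εC = 0≤^ C (ℚ.<⇒≤ ε>0)
    εC*xC≡1 : (ε ^ℚ C) ℚ.* (x ^ℚ C) ≡ 1ℚ
    εC*xC≡1 = trans (sym (^ℚ-distrib-* ε x C)) (trans (cong (_^ℚ C) εx≡1) (1^ℚ C))

theorem5 : (∀ {h} (H : Graph h) (ε : ℚ) → 0ℚ < ε →
    Σ ℕ λ N → (N ≥ 1) ×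
    (∀ {n} (G : Graph n) → Free H G →
    Σ ℕ λ k → (k Data.Nat.≤ N) × RestrictedPartition ε G k))
    ×
    (∀ {h} (H : Graph h) →
    PolyRödl H ⇔
    (Σ ℕ λ C → (0 Data.Nat.< C) ×
    (∀ (ε : ℚ) (ε>0 : 0ℚ < ε) → ε ≤ (+ 1) / 2 →
    ∀ {n} (G : Graph n) → Free H G →
    Σ ℕ λ k → (ℕ→ℚ k ≤ ((1/ ε) {{pos⇒nonZero ε {{positive ε>0}}}}) ^ℚ C)
    × RestrictedPartition ε G k)))
theorem5 = partition-exists , λ H →
  mk⇔ (PolyRödl⇒PolyPartition H) (PolyPartition⇒PolyRödl H)
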